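{- Let $m>0$ be an integer and let $\Gamma\subset\mathbb Z^2$ be a simply connected lattice region whose boundary is $\partial\Gamma=\alpha\cup\eta_+\cup\eta_-\cup\beta$, where $\alpha\subset\{x=0\}$ and $\beta\subset\{x=m\}$ are vertical intervals, and $\eta_+$ (upper boundary, joining the top endpoint of $\alpha$ to the top endpoint of $\beta$) and $\eta_-$ (lower boundary, joining the bottom endpoint of $\alpha$ to the bottom endpoint of $\beta$) are $x$-monotone lattice paths. Assume the origin $O=(0,0)$ lies in $\alpha$. Let $\{X_t\}$ be the simple (nearest neighbor, each of the four neighbors with probability $1/4$) lattice random walk on $\mathbb Z^2$ started at $X_0=O$, which is absorbed (killed) whenever it tries to step outside $\Gamma$. Let $T$ be the first time $t$ such that $X_t\in\beta$, and for $k\in\mathbb Z$ let $p(k)$ be the probability that $X_T=(m,k)$ (i.e. that the walk reaches $\beta$ before being absorbed, and does so first at the point $(m,k)$). Then $$p(k)^2\ \ge\ p(k+1)\,p(k-1)$$ for all $k\in\mathbb Z$ such that $(m,k+1)\in\beta$ and $(m,k-1)\in\beta$.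
   Context: A lattice path is a sequence of points of $\mathbb Z^2$ in which consecutive points are at Euclidean distance $1$ (it may self-intersect). An $x$-monotone lattice path is one along which the $x$-coordinate is weakly increasing. The region $\Gamma$ consists of the lattice points on and inside the closed curve $\partial\Gamma$. -}

module Defs where

open import Data.Nat as ℕ using (ℕ; zero; suc)
open import Data.Integer as ℤ using (ℤ; +_; -[1+_])
open import Data.Rational as ℚ using (ℚ; 0ℚ; 1ℚ)
open import Data.Bool using (Bool; true; false; _∧_; not; if_then_else_)
open import Data.Product using (_×_)
open import Relation.Nullary.Decidable using (⌊_⌋)

-- A lattice region Γ between the vertical lines x = 0 and x = m whose
-- upper and lower boundaries η₊, η₋ are x-monotone lattice paths.
-- Such a region is column-convex: its intersection with the column
-- {x = j} (0 ≤ j ≤ m) is the vertical interval [lo j, hi j]; since η₊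
-- and η₋ are lattice paths that do not cross, consecutive column
-- intervals overlap.  α = Γ ∩ {x = 0}, β = Γ ∩ {x = m}.
-- (Values of lo, hi at j > m are irrelevant.)
record Region (m : ℕ) : Set where
  field
    lo hi   : ℕ → ℤ
    lo≤hi   : ∀ j → j ℕ.≤ m → lo j ℤ.≤ hi j
    overlaps : ∀ j → j ℕ.< m → (lo (suc j) ℤ.≤ hi j) × (lo j ℤ.≤ hi (suc j))

open Region public

inΓ : ∀ {m} → Region m → ℤ → ℤ → Bool
inΓ {m} R (+ j)    y = (j ℕ.≤ᵇ m) ∧ ((lo R j ℤ.≤ᵇ y) ∧ (y ℤ.≤ᵇ hi R j))
inΓ {m} R -[1+ _ ] y = false

inβ : ∀ {m} → Region m → ℤ → ℤ → Bool
inβ {m} R x y = inΓ R x y ∧ ⌊ x ℤ.≟ + m ⌋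

ind : Bool → ℚ
ind b = if b then 1ℚ else 0ℚ

¼ : ℚ
¼ = (+ 1) ℚ./ 4

-- μ R n x y = probability that the simple random walk started at O,
-- killed when it tries to step outside Γ and stopped on hitting β,
-- is alive (not killed, not stopped before time n) at time n and X_n = (x , y).
-- For (x , y) ∈ β this is P(T = n and X_T = (x , y)).
μ : ∀ {m} → Region m → ℕ → ℤ → ℤ → ℚ
μ R zero    x y = ind (⌊ x ℤ.≟ + 0 ⌋ ∧ ⌊ y ℤ.≟ + 0 ⌋)
μ R (suc n) x y =
  ind (inΓ R x y) ℚ.*
    (step (x ℤ.- ℤ.1ℤ) y ℚ.+ step (x ℤ.+ ℤ.1ℤ) y ℚ.+
     step x (y ℤ.- ℤ.1ℤ) ℚ.+ step x (y ℤ.+ ℤ.1ℤ))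
  where
  step : ℤ → ℤ → ℚ
  step u w = ind (inΓ R u w ∧ not (inβ R u w)) ℚ.* μ R n u w ℚ.* ¼

-- partial sums: P(T ≤ N and X_T = (m , k))
pN : ∀ {m} → Region m → ℕ → ℤ → ℚ
pN {m} R zero    k = μ R zero (+ m) k
pN {m} R (suc N) k = pN R N k ℚ.+ μ R (suc N) (+ m) k

{-# OPTIONS --safe #-}
module Submission where

-- Let u_k(z) be the probability that the walk in Γ started at z first hits β at (m , k),
-- extended by 0 outside Γ; it is harmonic on Γ ∖ β.  Compare Γ with the taller region
-- Γ′ = Γ ∪ (Γ + (0 , 1)) and the corresponding functions u′_k.
--
-- Maximum principle and planarity: a combination s u′_k - t u′_(k+1) that is negative at a
-- point is negative along a path from it to (m , k + 1), and one that is positive at a point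
-- is positive along a path to (m , k).  If the second point lies above the first, these two
-- paths would have to cross.  Hence u′_(k+1) / u′_k increases from lower to higher points.
-- Since passing from Γ to Γ′ only adds walks through the new top points, this ratio at O is
-- at most as large in Γ as in Γ′.  Likewise, reflected, Γ′ ⊇ Γ + (0 , 1) adds walks through
-- the bottom points.  Together
--   p(k+1) / p(k)  ≤  u′_(k+1)(O) / u′_k(O)  ≤  p(k) / p(k-1).
--
-- All this is done at a finite time N, where the functions are harmonic up to an error δ.
-- The function φ(x) = 2 (m² - x²), whose neighbour average is φ - 1, absorbs this error: it
-- makes the combinations strictly superharmonic, so a path of decreasing values cannot stop
-- before leaving Γ ∖ β.  It also shows that δ tends to 0 as N grows.

open import Defs
open import Level using (0ℓ)
open import Data.Nat as ℕ using (ℕ; zero; suc)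
import Data.Nat.Properties as ℕP
import Data.Nat.Tactic.RingSolver as ℕSolver
open import Data.Integer as ℤ using (ℤ; +_; -[1+_]; 0ℤ; 1ℤ; +≤+)
import Data.Integer.Properties as ℤP
import Data.Integer.Tactic.RingSolver as ℤSolver
open import Data.Rational as ℚ using (ℚ; 0ℚ; 1ℚ; _+_; _*_; _-_; -_; _≤_; _<_)
open import Data.Rational.Properties
open import Data.Rational.Unnormalised as ℚᵘ using (mkℚᵘ)
import Data.Rational.Unnormalised.Properties as ℚᵘP
open import Data.Bool using (Bool; true; false; _∧_; _xor_; not; T)
open import Data.Bool.Properties using (T-≡; T-∧; ¬-not)
open import Data.Empty using (⊥-elim)
open import Data.Product using (_×_; _,_; proj₁; proj₂; ∃-syntax)
open import Data.Sum using (_⊎_; inj₁; inj₂; [_,_])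
open import Function using (_∘_; Equivalence)
open import Relation.Nullary using (Dec; yes; no; does; ¬_)
open import Relation.Nullary.Decidable using (⌊_⌋; _×-dec_; ¬?; dec-true; dec-false; dec⇒maybe; decidable-stable)
open import Relation.Binary.PropositionalEquality using (_≡_; _≢_; refl; sym; trans; cong; cong₂; subst; subst₂; module ≡-Reasoning)
open import Tactic.RingSolver using (solve-∀)
open import Tactic.RingSolver.Core.AlmostCommutativeRing using (AlmostCommutativeRing; fromCommutativeRing)


-- Crossing lattice paths

data Path (P : ℤ → ℤ → Set) (e f : ℤ) : ℤ → ℤ → Set where
  stop  : P e f → Path P e f e f
  west  : ∀ {x y} → P x y → Path P e f (x ℤ.- 1ℤ) y → Path P e f x y
  east  : ∀ {x y} → P x y → Path P e f (x ℤ.+ 1ℤ) y → Path P e f x y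
  south : ∀ {x y} → P x y → Path P e f x (y ℤ.- 1ℤ) → Path P e f x y
  north : ∀ {x y} → P x y → Path P e f x (y ℤ.+ 1ℤ) → Path P e f x y

path-start : ∀ {P e f x y} → Path P e f x y → P x y
path-start (stop p)    = p
path-start (west p _)  = p
path-start (east p _)  = p
path-start (south p _) = p
path-start (north p _) = p

path-end : ∀ {P e f x y} → Path P e f x y → P e f
path-end (stop p)    = p
path-end (west _ γ)  = path-end γ
path-end (east _ γ)  = path-end γ
path-end (south _ γ) = path-end γ
path-end (north _ γ) = path-end γ

i-1+1 : ∀ i → i ℤ.- 1ℤ ℤ.+ 1ℤ ≡ i
i-1+1 = ℤSolver.solve-∀

i+1-1 : ∀ i → i ℤ.+ 1ℤ ℤ.- 1ℤ ≡ i
i+1-1 = ℤSolver.solve-∀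

-- One test with two uses. For a point it says whether `(a , b)` lies on the vertical half-line from
-- `(i , j)` upwards. For the left end of a horizontal edge it says whether the edge joins the
-- columns `i` and `i + 1` at height at least `j`.
above : ℤ → ℤ → ℤ → ℤ → Bool
above i j a b = does ((a ℤ.≟ i) ×-dec (j ℤ.≤? b))

-- The contribution of the horizontal ray running to the right from the end `(e , f)` of a path.
beyond : ℤ → ℤ → ℤ → ℤ → Bool
beyond i j e f = does ((e ℤ.≤? i) ×-dec (j ℤ.≤? f))

-- Parity of the number of horizontal edges between the columns i and i + 1 at
-- height at least j, the path being prolonged from its end horizontally to the right.
crossings : ∀ {P e f x y} → ℤ → ℤ → Path P e f x y → Bool
crossings {e = e} {f} i j (stop _) = beyond i j e f
crossings {x = x} {y} i j (west _ γ)  = above i j (x ℤ.- 1ℤ) y xor crossings i j γ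
crossings {x = x} {y} i j (east _ γ)  = above i j x y xor crossings i j γ
crossings i j (south _ γ) = crossings i j γ
crossings i j (north _ γ) = crossings i j γ

does-cong : ∀ {A B : Set} (a : Dec A) (b : Dec B) → (A → B) → (B → A) → does a ≡ does b
does-cong (yes p) b f g = sym (dec-true b (f p))
does-cong (no ¬p) b f g = sym (dec-false b (¬p ∘ g))


<⇒+1≤ : ∀ {i j} → i ℤ.< j → i ℤ.+ 1ℤ ℤ.≤ j
<⇒+1≤ {i} {j} i<j = subst (ℤ._≤ j) (ℤP.+-comm 1ℤ i) (ℤP.i<j⇒suc[i]≤j i<j)

≤+1-cases : ∀ {i j} → i ℤ.≤ j ℤ.+ 1ℤ → i ≡ j ℤ.+ 1ℤ ⊎ i ℤ.≤ j
≤+1-cases {i} {j} p with i ℤ.≤? j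
... | yes q = inj₂ q
... | no ¬q = inj₁ (ℤP.≤-antisym p (<⇒+1≤ (ℤP.≰⇒> ¬q)))

i≤i+1 : ∀ i → i ℤ.≤ i ℤ.+ 1ℤ
i≤i+1 i = ℤP.i≤i+j i 1ℤ

i+1≰i : ∀ {i} → ¬ (i ℤ.+ 1ℤ ℤ.≤ i)
i+1≰i {i} p = ℤP.<-irrefl refl (ℤP.suc[i]≤j⇒i<j (subst (ℤ._≤ i) (ℤP.+-comm i 1ℤ) p))

above-shift : ∀ i j x y → above (i ℤ.+ 1ℤ) j (x ℤ.+ 1ℤ) y ≡ above i j x y
above-shift i j x y = does-cong ((x ℤ.+ 1ℤ ℤ.≟ i ℤ.+ 1ℤ) ×-dec (j ℤ.≤? y)) ((x ℤ.≟ i) ×-dec (j ℤ.≤? y))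
  (λ (p , q) → trans (sym (i+1-1 x)) (trans (cong (ℤ._- 1ℤ) p) (i+1-1 i)) , q)
  (λ (p , q) → cong (ℤ._+ 1ℤ) p , q)

-- A vertical step changes membership in the half-line only by entering or leaving it at its lowest
-- point `(i , j)`, which is not in `P`.
above-north : ∀ {P : ℤ → ℤ → Set} {i j x y} → ¬ P i j → P x (y ℤ.+ 1ℤ) →
  above i j x (y ℤ.+ 1ℤ) ≡ above i j x y
above-north {P} {i} {j} {x} {y} ¬Pij Pxy =
  does-cong ((x ℤ.≟ i) ×-dec (j ℤ.≤? y ℤ.+ 1ℤ)) ((x ℤ.≟ i) ×-dec (j ℤ.≤? y))
    to (λ (p , q) → p , ℤP.≤-trans q (i≤i+1 y))
  where
  to : x ≡ i × j ℤ.≤ y ℤ.+ 1ℤ → x ≡ i × j ℤ.≤ y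
  to (refl , q) with ≤+1-cases {j} {y} q
  ... | inj₁ refl = ⊥-elim (¬Pij Pxy)
  ... | inj₂ r    = refl , r

above-raise : ∀ {P : ℤ → ℤ → Set} {i j x y} → ¬ P i j → P x y →
  above i j x y ≡ above i (j ℤ.+ 1ℤ) x y
above-raise {P} {i} {j} {x} {y} ¬Pij Pxy =
  does-cong ((x ℤ.≟ i) ×-dec (j ℤ.≤? y)) ((x ℤ.≟ i) ×-dec (j ℤ.+ 1ℤ ℤ.≤? y))
    to (λ (p , q) → p , ℤP.≤-trans (i≤i+1 j) q)
  where
  to : x ≡ i × j ℤ.≤ y → x ≡ i × j ℤ.+ 1ℤ ℤ.≤ y
  to (refl , q) = refl , <⇒+1≤ (ℤP.≤∧≢⇒< q λ { refl → ¬Pij Pxy })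

beyond-east : ∀ i j e f → beyond (i ℤ.+ 1ℤ) j e f ≡ above (i ℤ.+ 1ℤ) j e f xor beyond i j e f
beyond-east i j e f with e ℤ.≟ i ℤ.+ 1ℤ | e ℤ.≤? i ℤ.+ 1ℤ | e ℤ.≤? i | j ℤ.≤? f
... | yes refl | _     | yes q | _     = ⊥-elim (i+1≰i q)
... | yes p    | no q  | no _  | _     = ⊥-elim (q (ℤP.≤-reflexive p))
... | yes _    | yes _ | no _  | yes _ = refl
... | yes _    | yes _ | no _  | no _  = refl
... | no _     | yes _ | yes _ | yes _ = refl
... | no _     | yes _ | yes _ | no _  = refl
... | no p     | yes q | no r  | _     = ⊥-elim ([ p , r ] (≤+1-cases {e} {i} q))
... | no _     | no q  | yes r | _     = ⊥-elim (q (ℤP.≤-trans r (i≤i+1 i)))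
... | no _     | no _  | no _  | yes _ = refl
... | no _     | no _  | no _  | no _  = refl

xor-swap : ∀ a b → a xor (a xor b) ≡ b
xor-swap true  true  = refl
xor-swap true  false = refl
xor-swap false _     = refl

-- Consider the half-line from `(i + 1 , j)` upwards. Its lowest point is off the path, so the
-- prolonged path enters and leaves it through horizontal edges only: western ones are counted at
-- `i`, eastern ones at `i + 1`. As the prolongation runs off to infinity, their total number is odd
-- exactly when the path starts on the half-line.
crossings-east : ∀ {P e f x y} i j (γ : Path P e f x y) → ¬ P (i ℤ.+ 1ℤ) j →
  crossings (i ℤ.+ 1ℤ) j γ ≡ above (i ℤ.+ 1ℤ) j x y xor crossings i j γ
crossings-east {e = e} {f} i j (stop _) ¬p = beyond-east i j e f
crossings-east {x = x} {y} i j (west _ γ) ¬p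
  rewrite crossings-east i j γ ¬p
        | sym (above-shift i j (x ℤ.- 1ℤ) y) | i-1+1 x
  = trans (xor-swap (above (i ℤ.+ 1ℤ) j (x ℤ.- 1ℤ) y) (crossings i j γ)) (sym (xor-swap (above (i ℤ.+ 1ℤ) j x y) (crossings i j γ)))
crossings-east {x = x} {y} i j (east _ γ) ¬p
  rewrite crossings-east i j γ ¬p | above-shift i j x y = refl
crossings-east {P} {x = x} {y} i j (south p γ) ¬p = trans (crossings-east i j γ ¬p)
  (cong (_xor crossings i j γ) (trans
    (sym (above-north {P} {i ℤ.+ 1ℤ} {j} {x} {y ℤ.- 1ℤ} ¬p (subst (P x) (sym (i-1+1 y)) p)))
    (cong (above (i ℤ.+ 1ℤ) j x) (i-1+1 y))))
crossings-east {P} {x = x} {y} i j (north p γ) ¬p = trans (crossings-east i j γ ¬p)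
  (cong (_xor crossings i j γ) (above-north {P} {i ℤ.+ 1ℤ} {j} {x} {y} ¬p (path-start γ)))

-- The counts differ by the edges at height exactly `j`, and each of these has `(i , j)` as its left
-- end. The condition `i ≤ e` covers the prolongation, which could otherwise pass through `(i , j)`
-- without the path doing so.
crossings-north : ∀ {P e f x y} i j (γ : Path P e f x y) → i ℤ.≤ e → ¬ P i j →
  crossings i j γ ≡ crossings i (j ℤ.+ 1ℤ) γ
crossings-north {P} {e} {f} i j (stop p) i≤e ¬p =
  does-cong ((e ℤ.≤? i) ×-dec (j ℤ.≤? f)) ((e ℤ.≤? i) ×-dec (j ℤ.+ 1ℤ ℤ.≤? f))
    to (λ (u , v) → u , ℤP.≤-trans (i≤i+1 j) v)
  where
  to : e ℤ.≤ i × j ℤ.≤ f → e ℤ.≤ i × j ℤ.+ 1ℤ ℤ.≤ f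
  to (u , v) = u , <⇒+1≤ (ℤP.≤∧≢⇒< v λ { refl → ¬p (subst (λ z → P z f) (ℤP.≤-antisym u i≤e) p) })
crossings-north {P} {x = x} i j (west p γ) i≤e ¬p =
  cong₂ _xor_ (above-raise {P} ¬p (path-start γ)) (crossings-north i j γ i≤e ¬p)
crossings-north {P} i j (east p γ) i≤e ¬p =
  cong₂ _xor_ (above-raise {P} ¬p p) (crossings-north i j γ i≤e ¬p)
crossings-north i j (south p γ) i≤e ¬p = crossings-north i j γ i≤e ¬p
crossings-north i j (north p γ) i≤e ¬p = crossings-north i j γ i≤e ¬p

crossings-empty : ∀ {P e f x y} i j (γ : Path P e f x y) →
  (∀ b → j ℤ.≤ b → P i b → ¬ P (i ℤ.+ 1ℤ) b) → crossings i j γ ≡ beyond i j e f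
crossings-empty i j (stop _) none = refl
crossings-empty {P} {x = x} {y} i j (west p γ) none = cong₂ _xor_
  (dec-false ((x ℤ.- 1ℤ ℤ.≟ i) ×-dec (j ℤ.≤? y)) λ { (refl , q) → none y q (path-start γ) (subst (λ z → P z y) (sym (i-1+1 x)) p) })
  (crossings-empty i j γ none)
crossings-empty {x = x} {y} i j (east p γ) none = cong₂ _xor_
  (dec-false ((x ℤ.≟ i) ×-dec (j ℤ.≤? y)) λ { (refl , q) → none y q p (path-start γ) })
  (crossings-empty i j γ none)
crossings-empty i j (south p γ) none = crossings-empty i j γ none
crossings-empty i j (north p γ) none = crossings-empty i j γ none

data In {m : ℕ} (R : Region m) : ℤ → ℤ → Set where
  inside : ∀ {i y} → i ℕ.≤ m → lo R i ℤ.≤ y → y ℤ.≤ hi R i → In R (+ i) y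

In-0≤ : ∀ {m} {R : Region m} {x y} → In R x y → 0ℤ ℤ.≤ x
In-0≤ (inside _ _ _) = +≤+ ℕ.z≤n

In-≤m : ∀ {m} {R : Region m} {x y} → In R x y → x ℤ.≤ + m
In-≤m (inside i≤m _ _) = +≤+ i≤m

module _ {m : ℕ} (R : Region m) {P Q : ℤ → ℤ → Set}
         (P⊆R : ∀ {x y} → P x y → In R x y) (Q⊆R : ∀ {x y} → Q x y → In R x y)
         (disjoint : ∀ {x y} → P x y → ¬ Q x y) where

  above-origin : ∀ {x y p} → Q x y → Q (x ℤ.+ 1ℤ) y → above (x ℤ.+ 1ℤ) y 0ℤ p ≡ false
  above-origin {x} {y} {p} q _ = dec-false ((0ℤ ℤ.≟ x ℤ.+ 1ℤ) ×-dec (y ℤ.≤? p))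
    λ (u , _) → i+1≰i (ℤP.≤-trans (ℤP.≤-reflexive (sym u)) (In-0≤ (Q⊆R q)))

  -- A point moving off γ cannot change the number of crossings above it, except where the
  -- prolonged γ has an end: the start of γ, which lies in the leftmost column.
  crossings-invariant : ∀ {f p e′ f′ x y} (γ : Path P (+ m) f 0ℤ p) → Path Q e′ f′ x y →
    crossings x y γ ≡ crossings e′ f′ γ
  crossings-invariant γ (stop q) = refl
  crossings-invariant {p = p} {x = x} {y} γ (west q η) = trans
    (trans (cong (λ z → crossings z y γ) (sym (i-1+1 x)))
      (trans (crossings-east (x ℤ.- 1ℤ) y γ (λ r → disjoint r q′))
        (cong (_xor crossings (x ℤ.- 1ℤ) y γ) (above-origin {p = p} (path-start η) q′))))
    (crossings-invariant γ η)
    where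
    q′ : Q (x ℤ.- 1ℤ ℤ.+ 1ℤ) y
    q′ = subst (λ z → Q z y) (sym (i-1+1 x)) q
  crossings-invariant {p = p} {x = x} {y} γ (east q η) = trans
    (sym (trans (crossings-east x y γ (λ r → disjoint r (path-start η)))
      (cong (_xor crossings x y γ) (above-origin {p = p} q (path-start η)))))
    (crossings-invariant γ η)
  crossings-invariant {x = x} {y} γ (south q η) = trans
    (trans (cong (λ z → crossings x z γ) (sym (i-1+1 y)))
      (sym (crossings-north x (y ℤ.- 1ℤ) γ (In-≤m (Q⊆R q)) (λ r → disjoint r (path-start η)))))
    (crossings-invariant γ η)
  crossings-invariant {x = x} {y} γ (north q η) = trans
    (crossings-north x y γ (In-≤m (Q⊆R q)) (λ r → disjoint r q))
    (crossings-invariant γ η)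

  -- No edge of `γ` lies to the right of column `m`. Only the prolongation counts, and it runs one
  -- unit above `(m , k)`.
  crossings-end : ∀ {p k} (γ : Path P (+ m) (k ℤ.+ 1ℤ) 0ℤ p) → crossings (+ m) k γ ≡ true
  crossings-end {k = k} γ = trans
    (crossings-empty (+ m) k γ (λ _ _ _ r → i+1≰i (In-≤m (P⊆R r))))
    (dec-true ((+ m ℤ.≤? + m) ×-dec (k ℤ.≤? k ℤ.+ 1ℤ)) (ℤP.≤-refl , i≤i+1 k))

  -- Start from column `-1`, where `γ` has no edges. Passing to column `0` could change the parity
  -- only if `γ` started at height at least `j`.
  crossings-left : ∀ {f p j} (γ : Path P (+ m) f 0ℤ p) → p ℤ.< j → Q 0ℤ j → crossings 0ℤ j γ ≡ false
  crossings-left {f} {p} {j} γ p<j q = trans (crossings-east (ℤ.- 1ℤ) j γ (λ r → disjoint r q))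
    (cong₂ _xor_
      (dec-false ((0ℤ ℤ.≟ 0ℤ) ×-dec (j ℤ.≤? p)) (λ (_ , j≤p) → ℤP.<⇒≱ p<j j≤p))
      (trans (crossings-empty (ℤ.- 1ℤ) j γ λ _ _ r _ → -1≱0 (In-0≤ (P⊆R r)))
        (dec-false ((+ m ℤ.≤? ℤ.- 1ℤ) ×-dec (j ℤ.≤? f)) λ ())))
    where
    -1≱0 : ¬ (0ℤ ℤ.≤ ℤ.- 1ℤ)
    -1≱0 ()

  -- The point `(i , j)` is in `Q` and is the top of its column, so every point of `γ` in column `i`
  -- lies strictly below it and nothing is counted.
  crossings-top : ∀ {f p i j} (γ : Path P (+ m) f 0ℤ p) → Q i j →
    (∀ y → In R i y → y ℤ.≤ j) → crossings i j γ ≡ false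
  crossings-top {f} {p} {i} {j} γ q top = trans
    (crossings-empty i j γ λ b j≤b r _ → meet j≤b r)
    (dec-false ((+ m ℤ.≤? i) ×-dec (j ℤ.≤? f)) λ (m≤i , j≤f) →
      meet j≤f (subst (λ z → P z f) (ℤP.≤-antisym m≤i (In-≤m (Q⊆R q))) (path-end γ)))
    where
    meet : ∀ {b} → j ℤ.≤ b → ¬ P i b
    meet {b} j≤b r = disjoint r (subst (Q i) (ℤP.≤-antisym j≤b (top b (P⊆R r))) q)

  -- The parity of crossings of `γ` is constant along a disjoint `η`, but it is even at the start of
  -- `η` and odd at its end.
  crossing-paths-meet : ∀ {k p i j} → Path P (+ m) (k ℤ.+ 1ℤ) 0ℤ p → Path Q (+ m) k i j →
    ¬ ((i ≡ 0ℤ × p ℤ.< j) ⊎ (∀ y → In R i y → y ℤ.≤ j))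
  crossing-paths-meet {k} γ η (inj₁ (refl , p<j))
    with () ← trans (sym (crossings-end {k = k} γ))
                (trans (sym (crossings-invariant γ η)) (crossings-left γ p<j (path-start η)))
  crossing-paths-meet {k} γ η (inj₂ top)
    with () ← trans (sym (crossings-end {k = k} γ))
                (trans (sym (crossings-invariant γ η)) (crossings-top γ (path-start η) top))

-- Descending paths of superharmonic functions

ℚ-ring : AlmostCommutativeRing 0ℓ 0ℓ
ℚ-ring = fromCommutativeRing +-*-commutativeRing (λ x → dec⇒maybe (0ℚ ≟ x))

2ℚ 4ℚ : ℚ
2ℚ = + 2 ℚ./ 1
4ℚ = + 4 ℚ./ 1

≤-by : ∀ {p q} d → 0ℚ ≤ d → p + d ≡ q → p ≤ q
≤-by {p} {q} d 0≤d eq = begin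
  p      ≡⟨ +-identityʳ p ⟨
  p + 0ℚ ≤⟨ +-monoʳ-≤ p 0≤d ⟩
  p + d  ≡⟨ eq ⟩
  q      ∎
  where open ≤-Reasoning

0≤diff : ∀ {p q} → p ≤ q → 0ℚ ≤ q - p
0≤diff {p} {q} p≤q = subst (_≤ q - p) (+-inverseʳ p) (+-monoˡ-≤ (- p) p≤q)

<⇒≱ : ∀ {p q} → p < q → ¬ (q ≤ p)
<⇒≱ p<q q≤p = <-irrefl refl (<-≤-trans p<q q≤p)

0≤+ : ∀ {p q} → 0ℚ ≤ p → 0ℚ ≤ q → 0ℚ ≤ p + q
0≤+ = +-mono-≤

0≤* : ∀ {p q} → 0ℚ ≤ p → 0ℚ ≤ q → 0ℚ ≤ p * q
0≤* {p} {q} 0≤p 0≤q = nonNegative⁻¹ _ {{nonNeg*nonNeg⇒nonNeg p {{ℚ.nonNegative 0≤p}} q {{ℚ.nonNegative 0≤q}}}}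

0≤4 : 0ℚ ≤ 4ℚ
0≤4 = nonNegative⁻¹ 4ℚ

fromℕ : ℕ → ℚ
fromℕ zero    = 0ℚ
fromℕ (suc n) = 1ℚ + fromℕ n

fromℕ-+ : ∀ m n → fromℕ (m ℕ.+ n) ≡ fromℕ m + fromℕ n
fromℕ-+ zero    n = sym (+-identityˡ _)
fromℕ-+ (suc m) n = trans (cong (_+_ 1ℚ) (fromℕ-+ m n)) (sym (+-assoc 1ℚ (fromℕ m) (fromℕ n)))

0≤fromℕ : ∀ n → 0ℚ ≤ fromℕ n
0≤fromℕ zero    = ≤-refl
0≤fromℕ (suc n) = 0≤+ (nonNegative⁻¹ 1ℚ) (0≤fromℕ n)

fromℕ-mono : ∀ {m n} → m ℕ.≤ n → fromℕ m ≤ fromℕ n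
fromℕ-mono {n = n} ℕ.z≤n = 0≤fromℕ n
fromℕ-mono (ℕ.s≤s p) = +-monoʳ-≤ 1ℚ (fromℕ-mono p)

fromℕ-≃ : ∀ n → ℚ.toℚᵘ (fromℕ n) ℚᵘ.≃ mkℚᵘ (+ n) 0
fromℕ-≃ zero    = ℚᵘP.≃-refl
fromℕ-≃ (suc n) = ℚᵘP.≃-trans (toℚᵘ-homo-+ 1ℚ (fromℕ n))
  (ℚᵘP.≃-trans (ℚᵘP.+-congʳ ℚᵘ.1ℚᵘ (fromℕ-≃ n))
    (ℚᵘ.*≡* (cong (λ z → (+ 1 ℤ.+ z) ℤ.* + 1) (ℤP.*-identityʳ (+ n)))))

<-fromℕ : ∀ q → ∃[ n ] q < fromℕ n
<-fromℕ q@(ℚ.mkℚ a d _) = suc ℤ.∣ a ∣ , toℚᵘ-cancel-< (ℚᵘP.<-respʳ-≃ (ℚᵘP.≃-sym (fromℕ-≃ (suc ℤ.∣ a ∣)))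
  (ℚᵘ.*<* (begin-strict
    a ℤ.* + 1                  ≡⟨ ℤP.*-identityʳ a ⟩
    a                          ≤⟨ a≤∣a∣ a ⟩
    + ℤ.∣ a ∣                   <⟨ ℤ.+<+ ℕP.≤-refl ⟩
    + suc ℤ.∣ a ∣               ≤⟨ +≤+ (ℕP.m≤m*n (suc ℤ.∣ a ∣) (suc d)) ⟩
    + (suc ℤ.∣ a ∣ ℕ.* suc d)   ≡⟨ ℤP.pos-* (suc ℤ.∣ a ∣) (suc d) ⟩
    + suc ℤ.∣ a ∣ ℤ.* + suc d   ∎)))
  where
  open ℤP.≤-Reasoning
  a≤∣a∣ : ∀ a → a ℤ.≤ + ℤ.∣ a ∣
  a≤∣a∣ (+ _)    = ℤP.≤-refl
  a≤∣a∣ -[1+ _ ] = ℤ.-≤+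

archimedean : ∀ e → 0ℚ < e → ∀ q → ∃[ n ] q < fromℕ n * e
archimedean e 0<e q =
  let n , p = <-fromℕ (q * ℚ.1/ e)
  in  n , subst (_< fromℕ n * e) eq (*-monoˡ-<-pos e p)
  where
  instance
    e-pos : ℚ.Positive e
    e-pos = ℚ.positive 0<e
    e-nonZero : ℚ.NonZero e
    e-nonZero = pos⇒nonZero e
  eq : q * ℚ.1/ e * e ≡ q
  eq = trans (*-assoc q (ℚ.1/ e) e) (trans (cong (q *_) (*-inverseˡ e)) (*-identityʳ q))

-- A sum rather than an average, so that harmonicity of `f` reads `nb f = 4 f`.
nb : (ℤ → ℤ → ℚ) → ℤ → ℤ → ℚ
nb f x y = f (x ℤ.- 1ℤ) y + f (x ℤ.+ 1ℤ) y + f x (y ℤ.- 1ℤ) + f x (y ℤ.+ 1ℤ)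

nb-comb : ∀ s t c (f g h : ℤ → ℤ → ℚ) x y →
  nb (λ x y → s * f x y - t * g x y + c * h x y) x y ≡ s * nb f x y - t * nb g x y + c * nb h x y
nb-comb s t c f g h x y = lemma s t c
  (f (x ℤ.- 1ℤ) y) (f (x ℤ.+ 1ℤ) y) (f x (y ℤ.- 1ℤ)) (f x (y ℤ.+ 1ℤ))
  (g (x ℤ.- 1ℤ) y) (g (x ℤ.+ 1ℤ) y) (g x (y ℤ.- 1ℤ)) (g x (y ℤ.+ 1ℤ))
  (h (x ℤ.- 1ℤ) y) (h (x ℤ.+ 1ℤ) y) (h x (y ℤ.- 1ℤ)) (h x (y ℤ.+ 1ℤ))
  where
  lemma : ∀ s t c f₁ f₂ f₃ f₄ g₁ g₂ g₃ g₄ h₁ h₂ h₃ h₄ →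
    (s * f₁ - t * g₁ + c * h₁) + (s * f₂ - t * g₂ + c * h₂) + (s * f₃ - t * g₃ + c * h₃) + (s * f₄ - t * g₄ + c * h₄)
    ≡ s * (f₁ + f₂ + f₃ + f₄) - t * (g₁ + g₂ + g₃ + g₄) + c * (h₁ + h₂ + h₃ + h₄)
  lemma = solve-∀ ℚ-ring

nb-diff : ∀ (f g : ℤ → ℤ → ℚ) x y → nb (λ x y → f x y - g x y) x y ≡ nb f x y - nb g x y
nb-diff f g x y = lemma
  (f (x ℤ.- 1ℤ) y) (f (x ℤ.+ 1ℤ) y) (f x (y ℤ.- 1ℤ)) (f x (y ℤ.+ 1ℤ))
  (g (x ℤ.- 1ℤ) y) (g (x ℤ.+ 1ℤ) y) (g x (y ℤ.- 1ℤ)) (g x (y ℤ.+ 1ℤ))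
  where
  lemma : ∀ f₁ f₂ f₃ f₄ g₁ g₂ g₃ g₄ → (f₁ - g₁) + (f₂ - g₂) + (f₃ - g₃) + (f₄ - g₄)
    ≡ (f₁ + f₂ + f₃ + f₄) - (g₁ + g₂ + g₃ + g₄)
  lemma = solve-∀ ℚ-ring

module _ (B : ℤ → ℤ → ℚ) (D : ℤ → ℤ → Set) (D? : ∀ x y → Dec (D x y))
         {e L : ℚ} (0<e : 0ℚ < e)
         (superharmonic : ∀ x y → D x y → nb B x y + 4ℚ * e ≤ 4ℚ * B x y)
         (bounded : ∀ x y → D x y → L ≤ B x y)
         (c : ℚ) where

  private
    Below : ℤ → ℤ → Set
    Below x y = B x y < c

  pigeonhole : ∀ b₁ b₂ b₃ b₄ b → b₁ + b₂ + b₃ + b₄ + 4ℚ * e ≤ 4ℚ * b →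
    b₁ + e ≤ b ⊎ b₂ + e ≤ b ⊎ b₃ + e ≤ b ⊎ b₄ + e ≤ b
  pigeonhole b₁ b₂ b₃ b₄ b h with b₁ + e ≤? b | b₂ + e ≤? b | b₃ + e ≤? b
  ... | yes p | _     | _     = inj₁ p
  ... | no _  | yes p | _     = inj₂ (inj₁ p)
  ... | no _  | no _  | yes p = inj₂ (inj₂ (inj₁ p))
  ... | no p₁ | no p₂ | no p₃ = inj₂ (inj₂ (inj₂ (≤-by _
        (0≤+ (0≤+ (0≤+ (0≤diff (<⇒≤ (≰⇒> p₁))) (0≤diff (<⇒≤ (≰⇒> p₂)))) (0≤diff (<⇒≤ (≰⇒> p₃)))) (0≤diff h))
        (lemma b₁ b₂ b₃ b₄ b e))))
    where
    lemma : ∀ b₁ b₂ b₃ b₄ b e →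
      b₄ + e + ((b₁ + e - b) + (b₂ + e - b) + (b₃ + e - b) + (4ℚ * b - (b₁ + b₂ + b₃ + b₄ + 4ℚ * e))) ≡ b
    lemma = solve-∀ ℚ-ring

  private
    lower : ∀ n {b b′} → b′ + e ≤ b → b < L + fromℕ (suc n) * e → b′ < L + fromℕ n * e
    lower n {b} {b′} p q = subst₂ _<_ (lemma₁ b′ e) (lemma₂ L (fromℕ n) e)
        (+-monoˡ-< (- e) (≤-<-trans p q))
      where
      lemma₁ : ∀ b e → b + e - e ≡ b
      lemma₁ = solve-∀ ℚ-ring
      lemma₂ : ∀ L n e → L + (1ℚ + n) * e - e ≡ L + n * e
      lemma₂ = solve-∀ ℚ-ring

    lower-c : ∀ {b b′} → b′ + e ≤ b → b < c → b′ < c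
    lower-c {b} {b′} p q = ≤-<-trans (≤-trans (≤-by e (<⇒≤ 0<e) refl) p) q

  -- Superharmonicity with margin `e` provides a neighbour whose value is lower by at least `e`.
  -- Inside `D` the values stay above `L`, so `n` such steps suffice to leave `D`.
  descent-fuel : ∀ n x y → B x y < L + fromℕ n * e → Below x y →
    ∃[ u ] ∃[ v ] Path Below u v x y × ¬ D u v
  descent-fuel n x y h b<c = go n h (D? x y)
    where
    go : ∀ n → B x y < L + fromℕ n * e → Dec (D x y) → ∃[ u ] ∃[ v ] Path Below u v x y × ¬ D u v
    go n       h (no ¬d) = x , y , stop b<c , ¬d
    go zero    h (yes d) = ⊥-elim (<⇒≱ h (≤-trans
      (≤-reflexive (trans (cong (_+_ L) (*-zeroˡ e)) (+-identityʳ L))) (bounded x y d)))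
    go (suc n) h (yes d) =
      [ move {x ℤ.- 1ℤ} {y} west , [ move {x ℤ.+ 1ℤ} {y} east , [ move {x} {y ℤ.- 1ℤ} south , move {x} {y ℤ.+ 1ℤ} north ] ] ] (pigeonhole
        (B (x ℤ.- 1ℤ) y) (B (x ℤ.+ 1ℤ) y) (B x (y ℤ.- 1ℤ)) (B x (y ℤ.+ 1ℤ)) (B x y) (superharmonic x y d))
      where
      move : ∀ {x′ y′} → (∀ {u v} → Below x y → Path Below u v x′ y′ → Path Below u v x y) →
        B x′ y′ + e ≤ B x y → ∃[ u ] ∃[ v ] Path Below u v x y × ¬ D u v
      move {x′} {y′} arrow p =
        let u , v , γ , ¬d = descent-fuel n x′ y′ (lower n p h) (lower-c p b<c)
        in  u , v , arrow b<c γ , ¬d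

  descent : ∀ {x y} → Below x y → ∃[ u ] ∃[ v ] Path Below u v x y × ¬ D u v
  descent {x} {y} b<c with archimedean e 0<e (B x y - L)
  ... | n , p = descent-fuel n x y (subst (_< L + fromℕ n * e) (lemma L (B x y)) (+-monoʳ-< L p)) b<c
    where
    lemma : ∀ L b → L + (b - L) ≡ b
    lemma = solve-∀ ℚ-ring

-- The strictly superharmonic function φ

sq : ℕ → ℕ
sq n = n ℕ.* n

-- The truncated subtraction keeps φ nonnegative on all columns; it is exact for ∣ x ∣ ≤ m.
φ : ℕ → ℤ → ℚ
φ m x = fromℕ (2 ℕ.* (sq m ℕ.∸ sq ℤ.∣ x ∣))

Φ : ℕ → ℚ
Φ m = fromℕ (2 ℕ.* sq m)

0≤φ : ∀ m x → 0ℚ ≤ φ m x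
0≤φ m x = 0≤fromℕ (2 ℕ.* (sq m ℕ.∸ sq ℤ.∣ x ∣))

φ≤Φ : ∀ m x → φ m x ≤ Φ m
φ≤Φ m x = fromℕ-mono (ℕP.*-monoʳ-≤ 2 (ℕP.m∸n≤m (sq m) (sq ℤ.∣ x ∣)))

-- Used for the squares of `i - 1`, `i + 1` and `i`, whose second difference is 2. The bounds by `M`
-- make the truncated subtractions exact.
∸-laplace : ∀ M a b c → a ℕ.≤ M → b ℕ.≤ M → c ℕ.≤ M → a ℕ.+ b ≡ c ℕ.+ c ℕ.+ 2 →
  2 ℕ.* (M ℕ.∸ a) ℕ.+ 2 ℕ.* (M ℕ.∸ b) ℕ.+ 4 ≡ 2 ℕ.* (M ℕ.∸ c) ℕ.+ 2 ℕ.* (M ℕ.∸ c)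
∸-laplace M a b c a≤M b≤M c≤M eq = ℕP.+-cancelʳ-≡ (2 ℕ.* (c ℕ.+ c)) _ _ (begin
  2 ℕ.* a′ ℕ.+ 2 ℕ.* b′ ℕ.+ 4 ℕ.+ 2 ℕ.* (c ℕ.+ c)        ≡⟨ lemma₁ a′ b′ c ⟩
  2 ℕ.* a′ ℕ.+ 2 ℕ.* b′ ℕ.+ 2 ℕ.* (c ℕ.+ c ℕ.+ 2)        ≡⟨ cong (λ z → 2 ℕ.* a′ ℕ.+ 2 ℕ.* b′ ℕ.+ 2 ℕ.* z) eq ⟨
  2 ℕ.* a′ ℕ.+ 2 ℕ.* b′ ℕ.+ 2 ℕ.* (a ℕ.+ b)              ≡⟨ lemma₂ a′ b′ a b ⟩
  2 ℕ.* (a′ ℕ.+ a) ℕ.+ 2 ℕ.* (b′ ℕ.+ b)                  ≡⟨ cong₂ (λ u v → 2 ℕ.* u ℕ.+ 2 ℕ.* v) (trans (ℕP.m∸n+n≡m a≤M) (sym (ℕP.m∸n+n≡m c≤M))) (trans (ℕP.m∸n+n≡m b≤M) (sym (ℕP.m∸n+n≡m c≤M))) ⟩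
  2 ℕ.* (c′ ℕ.+ c) ℕ.+ 2 ℕ.* (c′ ℕ.+ c)                  ≡⟨ lemma₃ c′ c ⟩
  2 ℕ.* c′ ℕ.+ 2 ℕ.* c′ ℕ.+ 2 ℕ.* (c ℕ.+ c)              ∎)
  where
  open ≡-Reasoning
  a′ b′ c′ : ℕ
  a′ = M ℕ.∸ a
  b′ = M ℕ.∸ b
  c′ = M ℕ.∸ c
  lemma₁ : ∀ a b c → 2 ℕ.* a ℕ.+ 2 ℕ.* b ℕ.+ 4 ℕ.+ 2 ℕ.* (c ℕ.+ c) ≡ 2 ℕ.* a ℕ.+ 2 ℕ.* b ℕ.+ 2 ℕ.* (c ℕ.+ c ℕ.+ 2)
  lemma₁ = ℕSolver.solve-∀
  lemma₂ : ∀ a b c d → 2 ℕ.* a ℕ.+ 2 ℕ.* b ℕ.+ 2 ℕ.* (c ℕ.+ d) ≡ 2 ℕ.* (a ℕ.+ c) ℕ.+ 2 ℕ.* (b ℕ.+ d)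
  lemma₂ = ℕSolver.solve-∀
  lemma₃ : ∀ a b → 2 ℕ.* (a ℕ.+ b) ℕ.+ 2 ℕ.* (a ℕ.+ b) ≡ 2 ℕ.* a ℕ.+ 2 ℕ.* a ℕ.+ 2 ℕ.* (b ℕ.+ b)
  lemma₃ = ℕSolver.solve-∀

-- The vertical neighbours contribute `φ` itself, so only the horizontal second difference remains.
-- The condition `i < m` keeps column `i + 1` within the range where `φ` is not truncated.
φ-laplace : ∀ {m i} y → i ℕ.< m → nb (λ x _ → φ m x) (+ i) y + 4ℚ ≡ 4ℚ * φ m (+ i)
φ-laplace {m} {i} y i<m = begin
  fromℕ a + fromℕ b + fromℕ c + fromℕ c + 4ℚ   ≡⟨ lemma₁ (fromℕ a) (fromℕ b) (fromℕ c) ⟩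
  (fromℕ a + fromℕ b + fromℕ 4) + (fromℕ c + fromℕ c) ≡⟨ cong (_+ (fromℕ c + fromℕ c)) (begin
    fromℕ a + fromℕ b + fromℕ 4      ≡⟨ cong (_+ fromℕ 4) (fromℕ-+ a b) ⟨
    fromℕ (a ℕ.+ b) + fromℕ 4        ≡⟨ fromℕ-+ (a ℕ.+ b) 4 ⟨
    fromℕ (a ℕ.+ b ℕ.+ 4)            ≡⟨ cong fromℕ (laplace i i<m) ⟩
    fromℕ (c ℕ.+ c)                  ≡⟨ fromℕ-+ c c ⟩
    fromℕ c + fromℕ c                ∎) ⟩
  (fromℕ c + fromℕ c) + (fromℕ c + fromℕ c)    ≡⟨ lemma₂ (fromℕ c) ⟩
  4ℚ * fromℕ c ∎
  where
  open ≡-Reasoning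
  weight : ℤ → ℕ
  weight x = 2 ℕ.* (sq m ℕ.∸ sq ℤ.∣ x ∣)
  a b c : ℕ
  a = weight (+ i ℤ.- 1ℤ)
  b = weight (+ i ℤ.+ 1ℤ)
  c = weight (+ i)
  sq-mono : ∀ {p q} → p ℕ.≤ q → sq p ℕ.≤ sq q
  sq-mono h = ℕP.*-mono-≤ h h
  i+1≤m : ∀ {i} → i ℕ.< m → i ℕ.+ 1 ℕ.≤ m
  i+1≤m {i} = subst (ℕ._≤ m) (ℕP.+-comm 1 i)
  laplace : ∀ i → i ℕ.< m →
    weight (+ i ℤ.- 1ℤ) ℕ.+ weight (+ i ℤ.+ 1ℤ) ℕ.+ 4 ≡ weight (+ i) ℕ.+ weight (+ i)
  -- At `i = 0` the western neighbour is column `-1`, whose absolute value is 1; both horizontal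
  -- neighbours have square 1.
  laplace zero    h = ∸-laplace (sq m) 1 1 0 (sq-mono h) (sq-mono h) ℕ.z≤n refl
  laplace (suc i) h = ∸-laplace (sq m) (sq i) (sq (suc i ℕ.+ 1)) (sq (suc i))
    (sq-mono (ℕP.≤-trans (ℕP.n≤1+n i) (ℕP.<⇒≤ h))) (sq-mono (i+1≤m h)) (sq-mono (ℕP.<⇒≤ h)) (lemma i)
    where
    lemma : ∀ i → i ℕ.* i ℕ.+ (suc i ℕ.+ 1) ℕ.* (suc i ℕ.+ 1) ≡ suc i ℕ.* suc i ℕ.+ suc i ℕ.* suc i ℕ.+ 2
    lemma = ℕSolver.solve-∀
  lemma₁ : ∀ a b c → a + b + c + c + 4ℚ ≡ (a + b + fromℕ 4) + (c + c)
  lemma₁ = solve-∀ ℚ-ring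
  lemma₂ : ∀ c → (c + c) + (c + c) ≡ 4ℚ * c
  lemma₂ = solve-∀ ℚ-ring

In? : ∀ {m} (R : Region m) x y → Dec (In R x y)
In? R -[1+ _ ] y = no λ ()
In? {m} R (+ i) y with i ℕ.≤? m | lo R i ℤ.≤? y | y ℤ.≤? hi R i
... | yes p | yes q | yes r = yes (inside p q r)
... | no ¬p | _     | _     = no λ { (inside p _ _) → ¬p p }
... | yes _ | no ¬q | _     = no λ { (inside _ q _) → ¬q q }
... | yes _ | yes _ | no ¬r = no λ { (inside _ _ r) → ¬r r }

Inner : ∀ {m} → Region m → ℤ → ℤ → Set
Inner {m} R x y = In R x y × x ≢ + m

Inner? : ∀ {m} (R : Region m) x y → Dec (Inner R x y)
Inner? {m} R x y = In? R x y ×-dec ¬? (x ℤ.≟ + m)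

φ₂ : ℕ → ℤ → ℤ → ℚ
φ₂ m x _ = φ m x

φ-inner : ∀ {m} {R : Region m} {x y} → Inner R x y → nb (φ₂ m) x y ≡ 4ℚ * φ m x - 4ℚ
φ-inner {m} {x = x} {y} (inside {i} i≤m _ _ , i≢m) = trans (lemma (nb (φ₂ m) x y))
  (cong (_- 4ℚ) (φ-laplace {m} {i} y (ℕP.≤∧≢⇒< i≤m λ { refl → i≢m refl })))
  where
  lemma : ∀ z → z ≡ z + 4ℚ - 4ℚ
  lemma = solve-∀ ℚ-ring

-- Ratios of approximate hitting probabilities

-- v approximates the probability of first hitting the column x = m at (m , k).
record Approx {m : ℕ} (R : Region m) (δ : ℚ) (k : ℤ) (v : ℤ → ℤ → ℚ) : Set where
  field
    0≤v   : ∀ x y → 0ℚ ≤ v x y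
    v≤1   : ∀ x y → v x y ≤ 1ℚ
    off   : ∀ {x y} → ¬ In R x y → v x y ≡ 0ℚ
    sub   : ∀ {x y} → Inner R x y → 4ℚ * v x y ≤ nb v x y
    super : ∀ {x y} → Inner R x y → nb v x y ≤ 4ℚ * (v x y + δ)
    hit   : v (+ m) k ≡ 1ℚ
    miss  : ∀ {y} → y ≢ k → v (+ m) y ≡ 0ℚ

open Approx

comb : ℚ → ℚ → ℚ → (u v w : ℤ → ℤ → ℚ) → ℤ → ℤ → ℚ
comb s t c u v w x y = s * u x y - t * v x y + c * w x y

-- The bound on the correction term `4ℚ * δ * φ m x` that holds in every column.
error : ℕ → ℚ → ℚ
error m δ = 4ℚ * δ * Φ m

comb-nonneg : ∀ s t c a b d → 0ℚ ≤ s → 0ℚ ≤ c → 0ℚ ≤ a → 0ℚ ≤ d → b ≡ 0ℚ → 0ℚ ≤ s * a - t * b + c * d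
comb-nonneg s t c a .0ℚ d 0≤s 0≤c 0≤a 0≤d refl =
  ≤-by _ (0≤+ (0≤* 0≤s 0≤a) (0≤* 0≤c 0≤d)) (lemma s t c a d)
  where
  lemma : ∀ s t c a d → 0ℚ + (s * a + c * d) ≡ s * a - t * 0ℚ + c * d
  lemma = solve-∀ ℚ-ring

module _ {m : ℕ} {R : Region m} {δ : ℚ} (0<δ : 0ℚ < δ) where

  private
    0≤δ : 0ℚ ≤ δ
    0≤δ = <⇒≤ 0<δ

    0≤4δ : 0ℚ ≤ 4ℚ * δ
    0≤4δ = 0≤* 0≤4 0≤δ

    0<2δ : 0ℚ < 2ℚ * δ
    0<2δ = subst (_< 2ℚ * δ) (*-zeroʳ 2ℚ) (*-monoʳ-<-pos 2ℚ 0<δ)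

  module _ {k l : ℤ} {u v : ℤ → ℤ → ℚ} (U : Approx R δ k u) (V : Approx R δ l v)
           {s t : ℚ} (0≤s : 0ℚ ≤ s) (s≤2 : s ≤ 2ℚ) (0≤t : 0ℚ ≤ t) (t≤2 : t ≤ 2ℚ) where

    barrier : ℤ → ℤ → ℚ
    barrier = comb s t (4ℚ * δ) u v (φ₂ m)

    -- The correction lowers the neighbour sum by `16 δ`. The defect of `u` raises it by at most
    -- `4 s δ ≤ 8 δ`, that of `v` has the favourable sign, and `8 δ = 4 (2 δ)` is left as margin.
    comb-superharmonic : ∀ x y → Inner R x y → nb barrier x y + 4ℚ * (2ℚ * δ) ≤ 4ℚ * barrier x y
    comb-superharmonic x y d = ≤-by _
      (0≤+ (0≤+ (0≤* 0≤s (0≤diff (super U d))) (0≤* 0≤t (0≤diff (sub V d)))) (0≤* 0≤4δ (0≤diff s≤2)))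
      (trans (cong (λ z → z + 4ℚ * (2ℚ * δ) + rest) (trans (nb-comb s t (4ℚ * δ) u v (φ₂ m) x y)
          (cong (λ z → s * nb u x y - t * nb v x y + 4ℚ * δ * z) (φ-inner d))))
        (lemma s t δ (u x y) (v x y) (φ m x) (nb u x y) (nb v x y)))
      where
      rest : ℚ
      rest = s * (4ℚ * (u x y + δ) - nb u x y) + t * (nb v x y - 4ℚ * v x y) + 4ℚ * δ * (2ℚ - s)
      lemma : ∀ s t δ a b φ na nb →
        s * na - t * nb + 4ℚ * δ * (4ℚ * φ - 4ℚ) + 4ℚ * (2ℚ * δ)
          + (s * (4ℚ * (a + δ) - na) + t * (nb - 4ℚ * b) + 4ℚ * δ * (2ℚ - s))
        ≡ 4ℚ * (s * a - t * b + 4ℚ * δ * φ)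
      lemma = solve-∀ ℚ-ring

    comb-bounded : ∀ x y → Inner R x y → - 2ℚ ≤ barrier x y
    comb-bounded x y _ = ≤-by _
      (0≤+ (0≤+ (0≤+ (0≤* 0≤s (0≤v U x y)) (0≤* 0≤4δ (0≤φ m x))) (0≤diff t≤2)) (0≤* 0≤t (0≤diff (v≤1 V x y))))
      (lemma s t (4ℚ * δ) (u x y) (v x y) (φ m x))
      where
      lemma : ∀ s t c a b f → - 2ℚ + (s * a + c * f + (2ℚ - t) + t * (1ℚ - b)) ≡ s * a - t * b + c * f
      lemma = solve-∀ ℚ-ring

    -- Only `v` contributes negatively, so negative values occur only where `v` is nonzero. This
    -- keeps negative paths inside Γ and singles out their end point.
    comb-vanish : ∀ x y → v x y ≡ 0ℚ → ¬ (barrier x y < 0ℚ)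
    comb-vanish x y eq h = <⇒≱ h (comb-nonneg s t (4ℚ * δ) (u x y) (v x y) (φ m x) 0≤s 0≤4δ (0≤v U x y) (0≤φ m x) eq)

    negative⇒In : ∀ {x y} → barrier x y < 0ℚ → In R x y
    negative⇒In {x} {y} h = decidable-stable (In? R x y) λ ¬p → comb-vanish x y (off V ¬p) h

    -- Descent below 0 stops outside `Inner R`. Being still negative there, the path has stayed in
    -- Γ, so it has reached column `m`; on this column `v` vanishes except at height `l`.
    negative-path : ∀ {x y} → barrier x y < 0ℚ → Path (λ x y → barrier x y < 0ℚ) (+ m) l x y
    negative-path {x} {y} h =
      let a , b , γ , ¬d = descent barrier (Inner R) (Inner? R) 0<2δ comb-superharmonic comb-bounded 0ℚ h
      in  subst₂ (λ a b → Path (λ x y → barrier x y < 0ℚ) a b x y) (a≡m ¬d γ) (b≡l ¬d γ) γ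
      where
      a≡m : ∀ {a b} → ¬ Inner R a b → Path (λ x y → barrier x y < 0ℚ) a b x y → a ≡ + m
      a≡m {a} {b} ¬d γ = decidable-stable (a ℤ.≟ + m) λ a≢m → ¬d (negative⇒In (path-end γ) , a≢m)
      b≡l : ∀ {a b} → ¬ Inner R a b → Path (λ x y → barrier x y < 0ℚ) a b x y → b ≡ l
      b≡l {a} {b} ¬d γ = decidable-stable (b ℤ.≟ l) λ b≢l →
        comb-vanish a b (trans (cong (λ z → v z b) (a≡m ¬d γ)) (miss V b≢l)) (path-end γ)

  -- Suppose the bound fails. The uncorrected `s u - t v` at `(0 , p)` and `t v - s u` at `(i , j)`
  -- both equal `u₀ v₁ - v₀ u₁`, which lies so far below 0 that the correction cannot make up for
  -- it. Hence there are negative paths from `(0 , p)` to `(m , k + 1)` and from `(i , j)` to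
  -- `(m , k)`, and these would have to meet.
  two-point : ∀ {k u v} → Approx R δ k u → Approx R δ (k ℤ.+ 1ℤ) v → ∀ {p i j} →
    (i ≡ 0ℤ × p ℤ.< j) ⊎ (∀ y → In R i y → y ℤ.≤ j) →
    v 0ℤ p * u i j ≤ u 0ℤ p * v i j + error m δ
  two-point {k} {u} {v} U V {p} {i} {j} lies-above = ≮⇒≥ λ h →
    crossing-paths-meet R
      (negative⇒In U V 0≤s s≤2 0≤t t≤2) (negative⇒In V U 0≤t t≤2 0≤s s≤2)
      -- The two barriers add up to twice the correction, which is nonnegative, so they are nowhere
      -- both negative.
      (λ {x} {y} h₁ h₂ → <⇒≱ (+-mono-< h₁ h₂)
        (≤-by _ (0≤+ (0≤φ′ x) (0≤φ′ x)) (cancel s t (4ℚ * δ) (u x y) (v x y) (φ m x))))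
      {k = k}
      (negative-path U V 0≤s s≤2 0≤t t≤2 {0ℤ} {p}
        (≤-<-trans (≤-by _ (0≤* 0≤4δ (0≤diff (φ≤Φ m 0ℤ))) (at-lower (4ℚ * δ) u₀ u₁ v₀ v₁ (φ m 0ℤ) (Φ m))) (gap h)))
      (negative-path V U 0≤t t≤2 0≤s s≤2 {i} {j}
        (≤-<-trans (≤-by _ (0≤* 0≤4δ (0≤diff (φ≤Φ m i))) (at-upper (4ℚ * δ) u₀ u₁ v₀ v₁ (φ m i) (Φ m))) (gap h)))
      lies-above
    where
    u₀ u₁ v₀ v₁ s t : ℚ
    u₀ = u 0ℤ p
    u₁ = u i j
    v₀ = v 0ℤ p
    v₁ = v i j
    -- The mediant weights, for which s u - t v has opposite values at the two points.
    s = v₀ + v₁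
    t = u₀ + u₁
    0≤s : 0ℚ ≤ s
    0≤s = 0≤+ (0≤v V 0ℤ p) (0≤v V i j)
    s≤2 : s ≤ 2ℚ
    s≤2 = +-mono-≤ (v≤1 V 0ℤ p) (v≤1 V i j)
    0≤t : 0ℚ ≤ t
    0≤t = 0≤+ (0≤v U 0ℤ p) (0≤v U i j)
    t≤2 : t ≤ 2ℚ
    t≤2 = +-mono-≤ (v≤1 U 0ℤ p) (v≤1 U i j)
    0≤φ′ : ∀ x → 0ℚ ≤ 4ℚ * δ * φ m x
    0≤φ′ x = 0≤* 0≤4δ (0≤φ m x)
    gap : u₀ * v₁ + error m δ < v₀ * u₁ → u₀ * v₁ + error m δ - v₀ * u₁ < 0ℚ
    gap h = subst (u₀ * v₁ + error m δ - v₀ * u₁ <_) (+-inverseʳ (v₀ * u₁)) (+-monoˡ-< (- (v₀ * u₁)) h)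
    cancel : ∀ s t c u v f → 0ℚ + 0ℚ + (c * f + c * f) ≡ (s * u - t * v + c * f) + (t * v - s * u + c * f)
    cancel = solve-∀ ℚ-ring
    at-lower : ∀ c u₀ u₁ v₀ v₁ f F →
      (v₀ + v₁) * u₀ - (u₀ + u₁) * v₀ + c * f + c * (F - f) ≡ u₀ * v₁ + c * F - v₀ * u₁
    at-lower = solve-∀ ℚ-ring
    at-upper : ∀ c u₀ u₁ v₀ v₁ f F →
      (u₀ + u₁) * v₁ - (v₀ + v₁) * u₁ + c * f + c * (F - f) ≡ u₀ * v₁ + c * F - v₀ * u₁
    at-upper = solve-∀ ℚ-ring

-- Comparison with the region enlarged by a top row

extend : ∀ {m} → Region m → Region m
lo       (extend R)       = lo R
hi       (extend R) j     = hi R j ℤ.+ 1ℤ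
lo≤hi    (extend R) j j≤m = ℤP.≤-trans (lo≤hi R j j≤m) (i≤i+1 (hi R j))
overlaps (extend R) j j<m =
  ℤP.≤-trans (proj₁ (overlaps R j j<m)) (i≤i+1 (hi R j)) ,
  ℤP.≤-trans (proj₂ (overlaps R j j<m)) (i≤i+1 (hi R (suc j)))

In-extend : ∀ {m} {R : Region m} {x y} → In R x y → In (extend R) x y
In-extend {R = R} (inside {i} i≤m l h) = inside i≤m l (ℤP.≤-trans h (i≤i+1 (hi R i)))

extend-top : ∀ {m} {R : Region m} {x y} → In (extend R) x y → ¬ In R x y →
  ∀ z → In (extend R) x z → z ℤ.≤ y
extend-top {R = R} {y = y} (inside {i} i≤m l h) ¬p z (inside _ _ z≤) with ≤+1-cases {y} {hi R i} h
... | inj₁ refl = z≤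
... | inj₂ y≤   = ⊥-elim (¬p (inside i≤m l y≤))

boundary-≡ : ∀ {m} {R S : Region m} {δ k u v} → Approx R δ k u → Approx S δ k v → ∀ y → u (+ m) y ≡ v (+ m) y
boundary-≡ {k = k} U V y with y ℤ.≟ k
... | yes refl = trans (hit U) (sym (hit V))
... | no y≢k   = trans (miss U y≢k) (sym (miss V y≢k))

module _ {m : ℕ} (R : Region m) {δ : ℚ} (0<δ : 0ℚ < δ) {k : ℤ} {u v u′ v′ : ℤ → ℤ → ℚ}
         (U : Approx R δ k u) (V : Approx R δ (k ℤ.+ 1ℤ) v)
         (U′ : Approx (extend R) δ k u′) (V′ : Approx (extend R) δ (k ℤ.+ 1ℤ) v′)
         {p : ℤ} (0≤p : 0ℤ ℤ.≤ p) where

  private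
    κ s t c : ℚ
    κ = error m δ
    s = v′ 0ℤ p
    t = u′ 0ℤ p
    c = 4ℚ * δ

    0≤s : 0ℚ ≤ s
    0≤s = 0≤v V′ 0ℤ p

    0≤t : 0ℚ ≤ t
    0≤t = 0≤v U′ 0ℤ p

    0≤c : 0ℚ ≤ c
    0≤c = 0≤* 0≤4 (<⇒≤ 0<δ)

    0≤κ : 0ℚ ≤ κ
    0≤κ = 0≤* 0≤c (0≤fromℕ (2 ℕ.* sq m))

    0<2δ : 0ℚ < 2ℚ * δ
    0<2δ = subst (_< 2ℚ * δ) (*-zeroʳ 2ℚ) (*-monoʳ-<-pos 2ℚ 0<δ)

    C : ℤ → ℤ → ℚ
    C = comb s t c (λ x y → u x y - u′ x y) (λ x y → v x y - v′ x y) (φ₂ m)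

    -- Now two defects are unfavourable, those of `u` and `v′`. With `s` and `t` at most 1 they cost
    -- at most `8 δ` together, out of the `16 δ` gained from the correction.
    superharmonic : ∀ x y → Inner R x y → nb C x y + 4ℚ * (2ℚ * δ) ≤ 4ℚ * C x y
    superharmonic x y d@(p , x≢m) = ≤-by _
      (0≤+ (0≤+ (0≤+ (0≤+ (0≤+ (0≤* 0≤s (0≤diff (super U d))) (0≤* 0≤s (0≤diff (sub U′ d′))))
        (0≤* 0≤t (0≤diff (sub V d)))) (0≤* 0≤t (0≤diff (super V′ d′))))
        (0≤* 0≤c (0≤diff (v≤1 V′ 0ℤ _)))) (0≤* 0≤c (0≤diff (v≤1 U′ 0ℤ _))))
      (trans (cong (λ z → z + 4ℚ * (2ℚ * δ) + rest) nC)
        (lemma s t δ (u x y) (u′ x y) (v x y) (v′ x y) (φ m x) (nb u x y) (nb u′ x y) (nb v x y) (nb v′ x y)))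
      where
      d′ : Inner (extend R) x y
      d′ = In-extend p , x≢m
      rest : ℚ
      rest = s * (4ℚ * (u x y + δ) - nb u x y) + s * (nb u′ x y - 4ℚ * u′ x y)
        + t * (nb v x y - 4ℚ * v x y) + t * (4ℚ * (v′ x y + δ) - nb v′ x y) + c * (1ℚ - s) + c * (1ℚ - t)
      comb3 : ℚ → ℚ → ℚ → ℚ
      comb3 a b f = s * a - t * b + c * f
      nC : nb C x y ≡ s * (nb u x y - nb u′ x y) - t * (nb v x y - nb v′ x y) + c * (4ℚ * φ m x - 4ℚ)
      nC = trans (nb-comb s t c (λ x y → u x y - u′ x y) (λ x y → v x y - v′ x y) (φ₂ m) x y)
        (trans (cong (λ a → comb3 a (nb (λ x y → v x y - v′ x y) x y) (nb (φ₂ m) x y)) (nb-diff u u′ x y))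
        (trans (cong (λ b → comb3 (nb u x y - nb u′ x y) b (nb (φ₂ m) x y)) (nb-diff v v′ x y))
          (cong (λ f → comb3 (nb u x y - nb u′ x y) (nb v x y - nb v′ x y) f) (φ-inner d))))
      lemma : ∀ s t δ a a′ b b′ φ na na′ nb nb′ →
        s * (na - na′) - t * (nb - nb′) + 4ℚ * δ * (4ℚ * φ - 4ℚ) + 4ℚ * (2ℚ * δ)
          + (s * (4ℚ * (a + δ) - na) + s * (na′ - 4ℚ * a′) + t * (nb - 4ℚ * b) + t * (4ℚ * (b′ + δ) - nb′)
             + 4ℚ * δ * (1ℚ - s) + 4ℚ * δ * (1ℚ - t))
        ≡ 4ℚ * (s * (a - a′) - t * (b - b′) + 4ℚ * δ * φ)
      lemma = solve-∀ ℚ-ring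

    bounded : ∀ x y → Inner R x y → - 2ℚ ≤ C x y
    bounded x y _ = ≤-by _
      (0≤+ (0≤+ (0≤+ (0≤+ (0≤+ (0≤+ (0≤* 0≤s (0≤v U x y)) (0≤* 0≤t (0≤v V′ x y))) (0≤* 0≤c (0≤φ m x)))
        (0≤diff (v≤1 V′ 0ℤ p))) (0≤* 0≤s (0≤diff (v≤1 U′ x y))))
        (0≤diff (v≤1 U′ 0ℤ p))) (0≤* 0≤t (0≤diff (v≤1 V x y))))
      (lemma s t c (u x y) (u′ x y) (v x y) (v′ x y) (φ m x))
      where
      lemma : ∀ s t c a a′ b b′ f →
        - 2ℚ + (s * a + t * b′ + c * f + (1ℚ - s) + s * (1ℚ - a′) + (1ℚ - t) + t * (1ℚ - b))
        ≡ s * (a - a′) - t * (b - b′) + c * f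
      lemma = solve-∀ ℚ-ring

    -- A point of the enlarged region outside Γ is the top of its column, so `two-point` applies
    -- whatever its column. Beyond the enlarged region both functions vanish.
    outside : ∀ {x y} → ¬ In R x y → s * u′ x y ≤ t * v′ x y + κ
    outside {x} {y} ¬p = by-cases (In? (extend R) x y)
      where
      by-cases : Dec (In (extend R) x y) → s * u′ x y ≤ t * v′ x y + κ
      by-cases (yes q) = two-point {R = extend R} 0<δ U′ V′ (inj₂ (extend-top q ¬p))
      by-cases (no ¬q) = ≤-by κ 0≤κ (trans (cong (λ z → s * z + κ) (off U′ ¬q))
        (trans (lemma s t κ) (cong (λ z → t * z + κ) (sym (off V′ ¬q)))))
        where
        lemma : ∀ s t κ → s * 0ℚ + κ ≡ t * 0ℚ + κ
        lemma = solve-∀ ℚ-ring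

    -- On column `m` the functions of the two regions agree and only the correction remains.
    -- Elsewhere `u` and `v` vanish, and `outside` controls what is left.
    exit : ∀ {x y} → ¬ Inner R x y → - κ ≤ C x y
    exit {x} {y} ¬d = by-cases (x ℤ.≟ + m)
      where
      by-cases : Dec (x ≡ + m) → - κ ≤ C x y
      by-cases (yes refl) = ≤-by _ (0≤+ 0≤κ (0≤* 0≤c (0≤φ m x)))
        (trans (lemma s t c κ (u′ x y) (v′ x y) (φ m x))
          (cong₂ (λ a b → s * (a - u′ x y) - t * (b - v′ x y) + c * φ m x)
            (sym (boundary-≡ U U′ y)) (sym (boundary-≡ V V′ y))))
        where
        lemma : ∀ s t c κ a b f → - κ + (κ + c * f) ≡ s * (a - a) - t * (b - b) + c * f
        lemma = solve-∀ ℚ-ring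
      by-cases (no x≢m) = ≤-by _ (0≤+ (0≤diff (outside ¬p)) (0≤* 0≤c (0≤φ m x)))
        (trans (lemma s t c κ (u′ x y) (v′ x y) (φ m x))
          (cong₂ (λ a b → s * (a - u′ x y) - t * (b - v′ x y) + c * φ m x)
            (sym (off U ¬p)) (sym (off V ¬p))))
        where
        ¬p : ¬ In R x y
        ¬p q = ¬d (q , x≢m)
        lemma : ∀ s t c κ a b f → - κ + (t * b + κ - s * a + c * f) ≡ s * (0ℚ - a) - t * (0ℚ - b) + c * f
        lemma = solve-∀ ℚ-ring

    C-bound : - κ ≤ C 0ℤ 0ℤ
    C-bound = ≮⇒≥ λ h →
      let a , b , γ , ¬d = descent C (Inner R) (Inner? R) 0<2δ superharmonic bounded (- κ) h
      in  <⇒≱ (path-end γ) (exit ¬d)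

    start : v′ 0ℤ 0ℤ * t ≤ u′ 0ℤ 0ℤ * s + κ
    start = by-cases (0ℤ ℤ.≟ p)
      where
      by-cases : Dec (0ℤ ≡ p) → v′ 0ℤ 0ℤ * t ≤ u′ 0ℤ 0ℤ * s + κ
      by-cases (yes refl) = ≤-by κ 0≤κ (cong (_+ κ) (*-comm s t))
      by-cases (no 0≢p)   = two-point {R = extend R} 0<δ U′ V′ (inj₁ (refl , ℤP.≤∧≢⇒< 0≤p 0≢p))

  -- Three errors accumulate: from the minimum principle for `C`, from comparing the origin with
  -- `(0 , p)` in the enlarged region, and from the correction at the origin. The height `p` is left
  -- free because reflecting the enlarged region moves the origin.
  extension-ratio : v 0ℤ 0ℤ * u′ 0ℤ p ≤ u 0ℤ 0ℤ * v′ 0ℤ p + (κ + κ + κ)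
  extension-ratio = ≤-by _ (0≤+ (0≤+ (0≤diff C-bound) (0≤diff start)) (0≤* 0≤c (0≤diff (φ≤Φ m 0ℤ))))
    (lemma s t c (u 0ℤ 0ℤ) (u′ 0ℤ 0ℤ) (v 0ℤ 0ℤ) (v′ 0ℤ 0ℤ) (φ m 0ℤ) (Φ m))
    where
    lemma : ∀ s t c a a′ b b′ f F →
      b * t + ((s * (a - a′) - t * (b - b′) + c * f - - (c * F)) + (a′ * s + c * F - b′ * t) + c * (F - f))
      ≡ a * s + (c * F + c * F + c * F)
    lemma = solve-∀ ℚ-ring

-- Reflection in a horizontal axis

reflect : ∀ {m} → Region m → Region m
-- Written as `0 - h` so that this is literally the flip `y ↦ c - y` with `c = 0`.
lo       (reflect R) j     = 0ℤ ℤ.- hi R j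
hi       (reflect R) j     = 0ℤ ℤ.- lo R j
lo≤hi    (reflect R) j j≤m = ℤP.+-monoʳ-≤ 0ℤ (ℤP.neg-mono-≤ (lo≤hi R j j≤m))
overlaps (reflect R) j j<m =
  ℤP.+-monoʳ-≤ 0ℤ (ℤP.neg-mono-≤ (proj₂ (overlaps R j j<m))) ,
  ℤP.+-monoʳ-≤ 0ℤ (ℤP.neg-mono-≤ (proj₁ (overlaps R j j<m)))

c-[c-y] : ∀ c y → c ℤ.- (c ℤ.- y) ≡ y
c-[c-y] = ℤSolver.solve-∀

c-mono : ∀ c {x y} → x ℤ.≤ y → c ℤ.- y ℤ.≤ c ℤ.- x
c-mono c p = ℤP.+-monoʳ-≤ c (ℤP.neg-mono-≤ p)

module _ {m : ℕ} {R R′ : Region m} (c : ℤ)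
         (lo≡ : ∀ j → lo R′ j ≡ c ℤ.- hi R j) (hi≡ : ∀ j → hi R′ j ≡ c ℤ.- lo R j) where

  In-flip : ∀ {x y} → In R′ x y → In R x (c ℤ.- y)
  In-flip {y = y} (inside {i} i≤m l h) = inside i≤m
    (subst (ℤ._≤ c ℤ.- y) (trans (cong (λ z → c ℤ.- z) (hi≡ i)) (c-[c-y] c (lo R i))) (c-mono c h))
    (subst (c ℤ.- y ℤ.≤_) (trans (cong (λ z → c ℤ.- z) (lo≡ i)) (c-[c-y] c (hi R i))) (c-mono c l))

  In-unflip : ∀ {x y} → In R x (c ℤ.- y) → In R′ x y
  In-unflip {y = y} (inside {i} i≤m l h) = inside i≤m
    (subst₂ ℤ._≤_ (sym (lo≡ i)) (c-[c-y] c y) (c-mono c h))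
    (subst₂ ℤ._≤_ (c-[c-y] c y) (sym (hi≡ i)) (c-mono c l))

  Approx-flip : ∀ {δ k k′ v} → k′ ≡ c ℤ.- k → Approx R δ k v → Approx R′ δ k′ (λ x y → v x (c ℤ.- y))
  Approx-flip {δ} {k} {_} {v} refl V = record
    { 0≤v   = λ x y → 0≤v V x (c ℤ.- y)
    ; v≤1   = λ x y → v≤1 V x (c ℤ.- y)
    ; off   = λ ¬p → off V (¬p ∘ In-unflip)
    ; sub   = λ {x} {y} (p , x≢m) →
        subst (4ℚ * v x (c ℤ.- y) ≤_) (nb-flip x y) (sub V (In-flip p , x≢m))
    ; super = λ {x} {y} (p , x≢m) →
        subst (_≤ 4ℚ * (v x (c ℤ.- y) + δ)) (nb-flip x y) (super V (In-flip p , x≢m))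
    ; hit   = trans (cong (v (+ m)) (c-[c-y] c k)) (hit V)
    ; miss  = λ {y} y≢ → miss V λ eq → y≢ (trans (sym (c-[c-y] c y)) (cong (λ z → c ℤ.- z) eq))
    }
    where
    swap : ∀ a b c d → a + b + c + d ≡ a + b + d + c
    swap = solve-∀ ℚ-ring
    c-pred : ∀ c y → c ℤ.- (y ℤ.- 1ℤ) ≡ c ℤ.- y ℤ.+ 1ℤ
    c-pred = ℤSolver.solve-∀
    c-suc : ∀ c y → c ℤ.- (y ℤ.+ 1ℤ) ≡ c ℤ.- y ℤ.- 1ℤ
    c-suc = ℤSolver.solve-∀
    nb-flip : ∀ x y → nb v x (c ℤ.- y) ≡ nb (λ x y → v x (c ℤ.- y)) x y
    nb-flip x y = trans
      (swap (v (x ℤ.- 1ℤ) (c ℤ.- y)) (v (x ℤ.+ 1ℤ) (c ℤ.- y)) (v x (c ℤ.- y ℤ.- 1ℤ)) (v x (c ℤ.- y ℤ.+ 1ℤ)))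
      (cong₂ (λ a b → v (x ℤ.- 1ℤ) (c ℤ.- y) + v (x ℤ.+ 1ℤ) (c ℤ.- y) + v x a + v x b)
        (sym (c-pred c y)) (sym (c-suc c y)))

-- The map y ↦ -y on R and y ↦ 1 - y on extend R turns the bottom row of extend R into the
-- top row of extend (reflect R).
lower-extension-ratio : ∀ {m} (R : Region m) {δ} → 0ℚ < δ → ∀ {k u w u′ v′} →
  Approx R δ k u → Approx R δ (k ℤ.- 1ℤ) w →
  Approx (extend R) δ k u′ → Approx (extend R) δ (k ℤ.+ 1ℤ) v′ →
  let κ = error m δ in
  w 0ℤ 0ℤ * v′ 0ℤ 0ℤ ≤ u 0ℤ 0ℤ * u′ 0ℤ 0ℤ + (κ + κ + κ)
lower-extension-ratio R 0<δ {k} U W U′ V′ = extension-ratio (reflect R) 0<δ {k = 0ℤ ℤ.- k}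
  (Approx-flip 0ℤ (λ _ → refl) (λ _ → refl) refl U)
  (Approx-flip 0ℤ (λ _ → refl) (λ _ → refl) (k-lemma₁ k) W)
  -- Under `y ↦ 1 - y` the targets `k + 1` and `k` become `- k` and `- k + 1`, so `V′` and `U′`
  -- exchange their roles.
  (Approx-flip 1ℤ (λ j → lo-lemma (hi R j)) (λ j → hi-lemma (lo R j)) (k-lemma₂ k) V′)
  (Approx-flip 1ℤ (λ j → lo-lemma (hi R j)) (λ j → hi-lemma (lo R j)) (k-lemma₃ k) U′)
  -- The same map sends the origin to height 1.
  {p = 1ℤ} (+≤+ ℕ.z≤n)
  where
  lo-lemma : ∀ h → 0ℤ ℤ.- h ≡ 1ℤ ℤ.- (h ℤ.+ 1ℤ)
  lo-lemma = ℤSolver.solve-∀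
  hi-lemma : ∀ l → 0ℤ ℤ.- l ℤ.+ 1ℤ ≡ 1ℤ ℤ.- l
  hi-lemma = ℤSolver.solve-∀
  k-lemma₁ : ∀ k → 0ℤ ℤ.- k ℤ.+ 1ℤ ≡ 0ℤ ℤ.- (k ℤ.- 1ℤ)
  k-lemma₁ = ℤSolver.solve-∀
  k-lemma₂ : ∀ k → 0ℤ ℤ.- k ≡ 1ℤ ℤ.- (k ℤ.+ 1ℤ)
  k-lemma₂ = ℤSolver.solve-∀
  k-lemma₃ : ∀ k → 0ℤ ℤ.- k ℤ.+ 1ℤ ≡ 1ℤ ℤ.- k
  k-lemma₃ = ℤSolver.solve-∀

-- Time reversal of the walk

nb-cong : ∀ {f g : ℤ → ℤ → ℚ} → (∀ x y → f x y ≡ g x y) → ∀ x y → nb f x y ≡ nb g x y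
nb-cong h x y = cong₂ _+_ (cong₂ _+_ (cong₂ _+_ (h _ _) (h _ _)) (h _ _)) (h _ _)

nb-mono : ∀ {f g : ℤ → ℤ → ℚ} → (∀ x y → f x y ≤ g x y) → ∀ x y → nb f x y ≤ nb g x y
nb-mono h x y = +-mono-≤ (+-mono-≤ (+-mono-≤ (h _ _) (h _ _)) (h _ _)) (h _ _)

nb-scale : ∀ c (f : ℤ → ℤ → ℚ) x y → nb (λ x y → c * f x y) x y ≡ c * nb f x y
nb-scale c f x y = lemma c (f (x ℤ.- 1ℤ) y) (f (x ℤ.+ 1ℤ) y) (f x (y ℤ.- 1ℤ)) (f x (y ℤ.+ 1ℤ))
  where
  lemma : ∀ c f₁ f₂ f₃ f₄ → c * f₁ + c * f₂ + c * f₃ + c * f₄ ≡ c * (f₁ + f₂ + f₃ + f₄)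
  lemma = solve-∀ ℚ-ring

nb-+ : ∀ (f g : ℤ → ℤ → ℚ) x y → nb (λ x y → f x y + g x y) x y ≡ nb f x y + nb g x y
nb-+ f g x y = lemma
  (f (x ℤ.- 1ℤ) y) (f (x ℤ.+ 1ℤ) y) (f x (y ℤ.- 1ℤ)) (f x (y ℤ.+ 1ℤ))
  (g (x ℤ.- 1ℤ) y) (g (x ℤ.+ 1ℤ) y) (g x (y ℤ.- 1ℤ)) (g x (y ℤ.+ 1ℤ))
  where
  lemma : ∀ f₁ f₂ f₃ f₄ g₁ g₂ g₃ g₄ → (f₁ + g₁) + (f₂ + g₂) + (f₃ + g₃) + (f₄ + g₄)
    ≡ (f₁ + f₂ + f₃ + f₄) + (g₁ + g₂ + g₃ + g₄)
  lemma = solve-∀ ℚ-ring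

nb-swap : ∀ (K : ℤ → ℤ → ℤ → ℤ → ℚ) x y a b →
  nb (λ u w → nb (K u w) a b) x y ≡ nb (λ c d → nb (λ u w → K u w c d) x y) a b
nb-swap K x y a b = sym (trans (nb-+ (λ c d → K₁ c d + K₂ c d + K₃ c d) K₄ a b)
  (cong (_+ nb K₄ a b) (trans (nb-+ (λ c d → K₁ c d + K₂ c d) K₃ a b)
    (cong (_+ nb K₃ a b) (nb-+ K₁ K₂ a b)))))
  where
  K₁ K₂ K₃ K₄ : ℤ → ℤ → ℚ
  K₁ = K (x ℤ.- 1ℤ) y
  K₂ = K (x ℤ.+ 1ℤ) y
  K₃ = K x (y ℤ.- 1ℤ)
  K₄ = K x (y ℤ.+ 1ℤ)

at : ℤ → ℤ → ℤ → ℤ → ℚ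
at a b x y = ind (⌊ x ℤ.≟ a ⌋ ∧ ⌊ y ℤ.≟ b ⌋)

at-refl : ∀ a b → at a b a b ≡ 1ℚ
at-refl a b with a ℤ.≟ a | b ℤ.≟ b
... | yes _ | yes _ = refl
... | no p  | _     = ⊥-elim (p refl)
... | yes _ | no p  = ⊥-elim (p refl)

at-≢ : ∀ a b x y → ¬ (x ≡ a × y ≡ b) → at a b x y ≡ 0ℚ
at-≢ a b x y h with x ℤ.≟ a | y ℤ.≟ b
... | yes p | yes q = ⊥-elim (h (p , q))
... | yes _ | no _  = refl
... | no _  | _     = refl

module _ {m : ℕ} (R : Region m) where

  live : ℤ → ℤ → Bool
  live x y = inΓ R x y ∧ not (inβ R x y)

  -- μ with an arbitrary starting point (a , b).
  walk : ℕ → ℤ → ℤ → ℤ → ℤ → ℚ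
  walk zero    a b x y = at a b x y
  walk (suc n) a b x y = ind (inΓ R x y) * nb (λ u w → ind (live u w) * walk n a b u w * ¼) x y

  walk-μ : ∀ n x y → walk n 0ℤ 0ℤ x y ≡ μ R n x y
  walk-μ zero    x y = refl
  walk-μ (suc n) x y = cong (ind (inΓ R x y) *_)
    (nb-cong (λ u w → cong (λ z → ind (live u w) * z * ¼) (walk-μ n u w)) x y)

  -- First-step decomposition, whereas `walk` is defined by its last step. Each step carries the
  -- weight `live` of its origin times `inΓ` of its target times `¼`, so a product of steps may be
  -- grouped from either end. The induction exchanges the sums over the first and the last step.
  walk-backward : ∀ n a b x y →
    walk (suc n) a b x y ≡ ind (live a b) * nb (λ c d → ind (inΓ R c d) * walk n c d x y * ¼) a b
  walk-backward zero a b x y = begin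
    g * nb (λ u w → ind (live u w) * at a b u w * ¼) x y
      ≡⟨ nb-scale g (λ u w → ind (live u w) * at a b u w * ¼) x y ⟨
    F (x ℤ.- 1ℤ) y + F (x ℤ.+ 1ℤ) y + F x (y ℤ.- 1ℤ) + F x (y ℤ.+ 1ℤ)
      -- Arriving at `(x , y)` from the west is leaving `(a , b)` to the east, and so on; the
      -- directions are therefore paired with their opposites.
      ≡⟨ cong₂ _+_ (cong₂ _+_ (cong₂ _+_
           (one-step (x ℤ.- 1ℤ) y (a ℤ.+ 1ℤ) b (λ { (refl , refl) → sym (i-1+1 x) , refl }) λ { (refl , refl) → i+1-1 a , refl })
           (one-step (x ℤ.+ 1ℤ) y (a ℤ.- 1ℤ) b (λ { (refl , refl) → sym (i+1-1 x) , refl }) λ { (refl , refl) → i-1+1 a , refl }))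
           (one-step x (y ℤ.- 1ℤ) a (b ℤ.+ 1ℤ) (λ { (refl , refl) → refl , sym (i-1+1 y) }) λ { (refl , refl) → refl , i+1-1 b }))
           (one-step x (y ℤ.+ 1ℤ) a (b ℤ.- 1ℤ) (λ { (refl , refl) → refl , sym (i+1-1 y) }) λ { (refl , refl) → refl , i-1+1 b }) ⟩
    G (a ℤ.+ 1ℤ) b + G (a ℤ.- 1ℤ) b + G a (b ℤ.+ 1ℤ) + G a (b ℤ.- 1ℤ)
      ≡⟨ reorder (G (a ℤ.+ 1ℤ) b) (G (a ℤ.- 1ℤ) b) (G a (b ℤ.+ 1ℤ)) (G a (b ℤ.- 1ℤ)) ⟩
    G (a ℤ.- 1ℤ) b + G (a ℤ.+ 1ℤ) b + G a (b ℤ.- 1ℤ) + G a (b ℤ.+ 1ℤ)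
      ≡⟨ nb-scale l (λ c d → ind (inΓ R c d) * at c d x y * ¼) a b ⟩
    l * nb (λ c d → ind (inΓ R c d) * at c d x y * ¼) a b ∎
    where
    open ≡-Reasoning
    g l : ℚ
    g = ind (inΓ R x y)
    l = ind (live a b)
    F G : ℤ → ℤ → ℚ
    F u w = g * (ind (live u w) * at a b u w * ¼)
    G c d = l * (ind (inΓ R c d) * at c d x y * ¼)
    reorder : ∀ a b c d → a + b + c + d ≡ b + a + d + c
    reorder = solve-∀ ℚ-ring
    one-step : ∀ u w c d → (u ≡ a × w ≡ b → x ≡ c × y ≡ d) → (x ≡ c × y ≡ d → u ≡ a × w ≡ b) → F u w ≡ G c d
    one-step u w c d to from = by-cases ((u ℤ.≟ a) ×-dec (w ℤ.≟ b))
      where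
      by-cases : Dec (u ≡ a × w ≡ b) → F u w ≡ G c d
      by-cases (no ¬p) = trans (cong (λ z → g * (ind (live u w) * z * ¼)) (at-≢ a b u w ¬p))
        (trans (lemma g (ind (live u w)) l (ind (inΓ R c d)) ¼)
          (cong (λ z → l * (ind (inΓ R c d) * z * ¼)) (sym (at-≢ c d x y (¬p ∘ from)))))
        where
        lemma : ∀ a b c d q → a * (b * 0ℚ * q) ≡ c * (d * 0ℚ * q)
        lemma = solve-∀ ℚ-ring
      by-cases (yes (refl , refl)) with refl , refl ← to (refl , refl) =
        trans (cong (λ z → g * (l * z * ¼)) (trans (at-refl a b) (sym (at-refl x y))))
          (lemma g l (at x y x y) ¼)
        where
        lemma : ∀ g l z q → g * (l * z * q) ≡ l * (g * z * q)
        lemma = solve-∀ ℚ-ring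
  walk-backward (suc n) a b x y = begin
    g * nb (λ u w → ind (live u w) * walk (suc n) a b u w * ¼) x y
      ≡⟨ nb-scale g (λ u w → ind (live u w) * walk (suc n) a b u w * ¼) x y ⟨
    nb (λ u w → g * (ind (live u w) * walk (suc n) a b u w * ¼)) x y
      ≡⟨ nb-cong (λ u w → begin
           g * (ind (live u w) * walk (suc n) a b u w * ¼)
             ≡⟨ cong (λ z → g * (ind (live u w) * z * ¼)) (walk-backward n a b u w) ⟩
           g * (ind (live u w) * (l * nb (λ c d → ind (inΓ R c d) * walk n c d u w * ¼) a b) * ¼)
             ≡⟨ regroup g (ind (live u w)) l _ ¼ ⟩
           g * ind (live u w) * l * ¼ * nb (λ c d → ind (inΓ R c d) * walk n c d u w * ¼) a b
             ≡⟨ nb-scale (g * ind (live u w) * l * ¼) (λ c d → ind (inΓ R c d) * walk n c d u w * ¼) a b ⟨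
           nb (K u w) a b ∎) x y ⟩
    nb (λ u w → nb (K u w) a b) x y
      ≡⟨ nb-swap K x y a b ⟩
    nb (λ c d → nb (λ u w → K u w c d) x y) a b
      ≡⟨ nb-cong (λ c d → begin
           nb (λ u w → K u w c d) x y
             ≡⟨ nb-cong (λ u w → reassoc g (ind (live u w)) l (ind (inΓ R c d)) (walk n c d u w) ¼) x y ⟩
           nb (λ u w → l * ind (inΓ R c d) * g * ¼ * (ind (live u w) * walk n c d u w * ¼)) x y
             ≡⟨ nb-scale (l * ind (inΓ R c d) * g * ¼) (λ u w → ind (live u w) * walk n c d u w * ¼) x y ⟩
           l * ind (inΓ R c d) * g * ¼ * nb (λ u w → ind (live u w) * walk n c d u w * ¼) x y
             ≡⟨ regroup l (ind (inΓ R c d)) g _ ¼ ⟨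
           l * (ind (inΓ R c d) * walk (suc n) c d x y * ¼) ∎) a b ⟩
    nb (λ c d → l * (ind (inΓ R c d) * walk (suc n) c d x y * ¼)) a b
      ≡⟨ nb-scale l (λ c d → ind (inΓ R c d) * walk (suc n) c d x y * ¼) a b ⟩
    l * nb (λ c d → ind (inΓ R c d) * walk (suc n) c d x y * ¼) a b ∎
    where
    open ≡-Reasoning
    g l : ℚ
    g = ind (inΓ R x y)
    l = ind (live a b)
    -- The weight of the walks with first step from `(a , b)` to `(c , d)`, last step from `(u , w)`
    -- to `(x , y)`, and `n` steps in between.
    K : ℤ → ℤ → ℤ → ℤ → ℚ
    K u w c d = g * ind (live u w) * l * ¼ * (ind (inΓ R c d) * walk n c d u w * ¼)
    regroup : ∀ g v l z q → g * (v * (l * z) * q) ≡ g * v * l * q * z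
    regroup = solve-∀ ℚ-ring
    reassoc : ∀ g v l i z q → g * v * l * q * (i * z * q) ≡ l * i * g * q * (v * z * q)
    reassoc = solve-∀ ℚ-ring

inΓ-T⇒In : ∀ {m} (R : Region m) {x y} → T (inΓ R x y) → In R x y
inΓ-T⇒In {m} R {+ i} {y} t =
  let p , t′ = Equivalence.to (T-∧ {i ℕ.≤ᵇ m}) t
      q , r  = Equivalence.to (T-∧ {lo R i ℤ.≤ᵇ y}) t′
  in  inside (ℕP.≤ᵇ⇒≤ i m p) (ℤP.≤ᵇ⇒≤ q) (ℤP.≤ᵇ⇒≤ r)

In⇒inΓ : ∀ {m} (R : Region m) {x y} → In R x y → inΓ R x y ≡ true
In⇒inΓ R (inside p q r) = Equivalence.to T-≡
  (Equivalence.from T-∧ (ℕP.≤⇒≤ᵇ p , Equivalence.from T-∧ (ℤP.≤⇒≤ᵇ q , ℤP.≤⇒≤ᵇ r)))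

¬In⇒inΓ : ∀ {m} (R : Region m) {x y} → ¬ In R x y → inΓ R x y ≡ false
¬In⇒inΓ R ¬p = ¬-not λ eq → ¬p (inΓ-T⇒In R (Equivalence.from T-≡ eq))

inβ⇒In : ∀ {m} (R : Region m) {y} → inβ R (+ m) y ≡ true → In R (+ m) y
inβ⇒In R eq = inΓ-T⇒In R (proj₁ (Equivalence.to T-∧ (Equivalence.from T-≡ eq)))

0≤ind : ∀ b → 0ℚ ≤ ind b
0≤ind true  = nonNegative⁻¹ 1ℚ
0≤ind false = ≤-refl

ind≤1 : ∀ b → ind b ≤ 1ℚ
ind≤1 true  = ≤-refl
ind≤1 false = nonNegative⁻¹ 1ℚ

live-inner : ∀ {m} (R : Region m) {x y} → Inner R x y → live R x y ≡ true
live-inner {m} R {x} {y} (p , x≢m) rewrite In⇒inΓ R p with x ℤ.≟ + m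
... | yes x≡m = ⊥-elim (x≢m x≡m)
... | no _    = refl

live-right : ∀ {m} (R : Region m) y → live R (+ m) y ≡ false
live-right {m} R y with inΓ R (+ m) y | + m ℤ.≟ + m
... | false | _      = refl
... | true  | yes _  = refl
... | true  | no m≢m = ⊥-elim (m≢m refl)

-- Hitting probabilities up to a finite time

module _ {m : ℕ} (R : Region m) (k : ℤ) where

  -- pN with an arbitrary starting point; unlike hits, cum need not vanish outside Γ.
  cum : ℕ → ℤ → ℤ → ℚ
  cum zero    x y = walk R zero x y (+ m) k
  cum (suc N) x y = cum N x y + walk R (suc N) x y (+ m) k

  hits : ℕ → ℤ → ℤ → ℚ
  hits N x y = ind (inΓ R x y) * cum N x y

  cum-pN : ∀ N → cum N 0ℤ 0ℤ ≡ pN R N k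
  cum-pN zero    = walk-μ R zero (+ m) k
  cum-pN (suc N) = cong₂ _+_ (cum-pN N) (walk-μ R (suc N) (+ m) k)

  hits-pN : ∀ N → In R 0ℤ 0ℤ → hits N 0ℤ 0ℤ ≡ pN R N k
  hits-pN N p = trans (cong (λ b → ind b * cum N 0ℤ 0ℤ) (In⇒inΓ R p))
    (trans (*-identityˡ (cum N 0ℤ 0ℤ)) (cum-pN N))

  -- Sums the first-step decompositions over all times from 1 to `N + 1`; time 0 has no first step
  -- and stays apart.
  cum-suc : ∀ N x y → cum (suc N) x y ≡ cum zero x y + ind (live R x y) * (¼ * nb (hits N) x y)
  cum-suc zero x y = cong (_+_ (cum zero x y)) (trans (walk-backward R zero x y (+ m) k)
    (cong (ind (live R x y) *_) (trans
      (nb-cong (λ c d → *-comm (ind (inΓ R c d) * cum zero c d) ¼) x y)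
      (nb-scale ¼ (hits zero) x y))))
  cum-suc (suc N) x y = begin
    cum (suc N) x y + walk R (suc (suc N)) x y (+ m) k
      ≡⟨ cong₂ _+_ (cum-suc N x y) (walk-backward R (suc N) x y (+ m) k) ⟩
    cum zero x y + l * (¼ * nb (hits N) x y) + l * nb (λ c d → ind (inΓ R c d) * walk R (suc N) c d (+ m) k * ¼) x y
      ≡⟨ cong (λ z → cum zero x y + l * (¼ * nb (hits N) x y) + l * z) (trans
           (nb-cong (λ c d → *-comm (ind (inΓ R c d) * walk R (suc N) c d (+ m) k) ¼) x y)
           (nb-scale ¼ W x y)) ⟩
    cum zero x y + l * (¼ * nb (hits N) x y) + l * (¼ * nb W x y)
      ≡⟨ lemma (cum zero x y) l ¼ (nb (hits N) x y) (nb W x y) ⟩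
    cum zero x y + l * (¼ * (nb (hits N) x y + nb W x y))
      ≡⟨ cong (λ z → cum zero x y + l * (¼ * z)) (trans (sym (nb-+ (hits N) W x y))
           (nb-cong (λ c d → sym (*-distribˡ-+ (ind (inΓ R c d)) (cum N c d) (walk R (suc N) c d (+ m) k))) x y)) ⟩
    cum zero x y + l * (¼ * nb (hits (suc N)) x y) ∎
    where
    open ≡-Reasoning
    l : ℚ
    l = ind (live R x y)
    W : ℤ → ℤ → ℚ
    W c d = ind (inΓ R c d) * walk R (suc N) c d (+ m) k
    lemma : ∀ a l q b c → a + l * (q * b) + l * (q * c) ≡ a + l * (q * (b + c))
    lemma = solve-∀ ℚ-ring

  hits-off : ∀ N {x y} → ¬ In R x y → hits N x y ≡ 0ℚ
  hits-off N {x} {y} ¬p = trans (cong (λ b → ind b * cum N x y) (¬In⇒inΓ R ¬p)) (*-zeroˡ (cum N x y))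

  cum-inner : ∀ {x y} → Inner R x y → cum zero x y ≡ 0ℚ
  cum-inner {x} {y} (_ , x≢m) = at-≢ x y (+ m) k λ (p , _) → x≢m (sym p)

  hits-inner₀ : ∀ {x y} → Inner R x y → hits zero x y ≡ 0ℚ
  hits-inner₀ {x} {y} d = trans (cong (ind (inΓ R x y) *_) (cum-inner d)) (*-zeroʳ (ind (inΓ R x y)))

  -- A discrete heat equation. Harmonicity of `hits N` thus fails only by its increment in time.
  hits-inner : ∀ N {x y} → Inner R x y → 4ℚ * hits (suc N) x y ≡ nb (hits N) x y
  hits-inner N {x} {y} d@(p , _) = begin
    4ℚ * (ind (inΓ R x y) * cum (suc N) x y)
      ≡⟨ cong₂ (λ b c → 4ℚ * (ind b * c)) (In⇒inΓ R p) (cum-suc N x y) ⟩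
    4ℚ * (1ℚ * (cum zero x y + ind (live R x y) * (¼ * nb (hits N) x y)))
      ≡⟨ cong₂ (λ b c → 4ℚ * (1ℚ * (c + ind b * (¼ * nb (hits N) x y)))) (live-inner R d) (cum-inner d) ⟩
    4ℚ * (1ℚ * (0ℚ + 1ℚ * (¼ * nb (hits N) x y)))
      ≡⟨ lemma (nb (hits N) x y) ⟩
    nb (hits N) x y ∎
    where
    open ≡-Reasoning
    lemma : ∀ z → 4ℚ * (1ℚ * (0ℚ + 1ℚ * (¼ * z))) ≡ z
    lemma = solve-∀ ℚ-ring

  -- A walk started on column `m` is not live, so times after 0 contribute nothing.
  cum-right : ∀ N y → cum N (+ m) y ≡ cum zero (+ m) y
  cum-right zero    y = refl
  cum-right (suc N) y = trans (cum-suc N (+ m) y)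
    (trans (cong (λ b → cum zero (+ m) y + ind b * (¼ * nb (hits N) (+ m) y)) (live-right R y))
      (lemma (cum zero (+ m) y) (¼ * nb (hits N) (+ m) y)))
    where
    lemma : ∀ a b → a + 0ℚ * b ≡ a
    lemma = solve-∀ ℚ-ring

  hits-hit : ∀ N → In R (+ m) k → hits N (+ m) k ≡ 1ℚ
  hits-hit N p = cong₂ (λ b c → ind b * c) (In⇒inΓ R p) (trans (cum-right N k) (at-refl (+ m) k))

  hits-miss : ∀ N {y} → y ≢ k → hits N (+ m) y ≡ 0ℚ
  hits-miss N {y} y≢k = trans (cong (ind (inΓ R (+ m) y) *_)
    (trans (cum-right N y) (at-≢ (+ m) y (+ m) k λ (_ , p) → y≢k (sym p)))) (*-zeroʳ (ind (inΓ R (+ m) y)))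

-- Convergence of the hitting probabilities

4-cancel-≤ : ∀ {p q} → 4ℚ * p ≤ 4ℚ * q → p ≤ q
4-cancel-≤ = *-cancelˡ-≤-pos 4ℚ

1≤φ : ∀ {m} {R : Region m} {x y} → Inner R x y → 1ℚ ≤ φ m x
1≤φ {m} (inside {i} i≤m _ _ , i≢m) = fromℕ-mono {1} (begin
  1                          ≤⟨ ℕP.m<n⇒0<n∸m (ℕP.*-mono-< i<m i<m) ⟩
  sq m ℕ.∸ sq i              ≤⟨ ℕP.m≤n*m (sq m ℕ.∸ sq i) 2 ⟩
  2 ℕ.* (sq m ℕ.∸ sq i)      ∎)
  where
  open ℕP.≤-Reasoning
  i<m : i ℕ.< m
  i<m = ℕP.≤∧≢⇒< i≤m λ { refl → i≢m refl }

module _ {m : ℕ} (R : Region m) (k : ℤ) where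

  hits-∉inner : ∀ N {x y} → ¬ Inner R x y → hits R k N x y ≡ hits R k zero x y
  hits-∉inner N {x} {y} ¬d = by-cases (x ℤ.≟ + m)
    where
    by-cases : Dec (x ≡ + m) → hits R k N x y ≡ hits R k zero x y
    by-cases (yes refl) = cong (ind (inΓ R x y) *_) (cum-right R k N y)
    by-cases (no x≢m)   = trans (hits-off R k N ¬p) (sym (hits-off R k zero ¬p))
      where
      ¬p : ¬ In R x y
      ¬p p = ¬d (p , x≢m)

  -- Induction on time for the heat equation: in the interior a claim passes through the neighbours,
  -- while elsewhere the values are frozen and the claim is inherited from time 0.
  hits-induct : (P : ℕ → ℤ → ℤ → Set) → (∀ x y → P zero x y) →
    (∀ N x y → ¬ Inner R x y → P zero x y → P (suc N) x y) →
    (∀ N → (∀ x y → P N x y) → ∀ x y → Inner R x y → P (suc N) x y) → ∀ N x y → P N x y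
  hits-induct P p₀ p-out p-in zero    x y = p₀ x y
  hits-induct P p₀ p-out p-in (suc N) x y = by-cases (Inner? R x y)
    where
    by-cases : Dec (Inner R x y) → P (suc N) x y
    by-cases (yes d) = p-in N (hits-induct P p₀ p-out p-in N) x y d
    by-cases (no ¬d) = p-out N x y ¬d (p₀ x y)

  0≤hits : ∀ N x y → 0ℚ ≤ hits R k N x y
  0≤hits = hits-induct (λ N x y → 0ℚ ≤ hits R k N x y)
    (λ x y → 0≤* (0≤ind (inΓ R x y)) (0≤ind _))
    (λ N x y ¬d → subst (0ℚ ≤_) (sym (hits-∉inner (suc N) ¬d)))
    (λ N ih x y d → 4-cancel-≤ (subst (4ℚ * 0ℚ ≤_) (sym (hits-inner R k N d)) (nb-mono {λ _ _ → 0ℚ} ih x y)))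

  hits≤1 : ∀ N x y → hits R k N x y ≤ 1ℚ
  hits≤1 = hits-induct (λ N x y → hits R k N x y ≤ 1ℚ)
    (λ x y → ≤-trans (*-monoˡ-≤-nonNeg (ind (inΓ R x y)) {{ℚ.nonNegative (0≤ind (inΓ R x y))}} (ind≤1 _))
      (subst (_≤ 1ℚ) (sym (*-identityʳ (ind (inΓ R x y)))) (ind≤1 (inΓ R x y))))
    (λ N x y ¬d → subst (_≤ 1ℚ) (sym (hits-∉inner (suc N) ¬d)))
    (λ N ih x y d → 4-cancel-≤ (subst (_≤ 4ℚ * 1ℚ) (sym (hits-inner R k N d)) (nb-mono {g = λ _ _ → 1ℚ} ih x y)))

  hits-mono : ∀ N x y → hits R k N x y ≤ hits R k (suc N) x y
  hits-mono = hits-induct (λ N x y → hits R k N x y ≤ hits R k (suc N) x y)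
    base
    (λ N x y ¬d _ → ≤-reflexive (trans (hits-∉inner (suc N) ¬d) (sym (hits-∉inner (suc (suc N)) ¬d))))
    (λ N ih x y d → 4-cancel-≤ (subst₂ _≤_ (sym (hits-inner R k N d)) (sym (hits-inner R k (suc N) d)) (nb-mono ih x y)))
    where
    base : ∀ x y → hits R k zero x y ≤ hits R k 1 x y
    base x y = by-cases (Inner? R x y)
      where
      by-cases : Dec (Inner R x y) → hits R k zero x y ≤ hits R k 1 x y
      by-cases (yes d) = subst (_≤ hits R k 1 x y) (sym (hits-inner₀ R k d)) (0≤hits 1 x y)
      by-cases (no ¬d) = ≤-reflexive (sym (hits-∉inner 1 ¬d))

  module _ (0<m : 0 ℕ.< m) where

    increment : ℕ → ℤ → ℤ → ℚ
    increment N x y = hits R k (suc N) x y - hits R k N x y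

    -- The increments decay like `1 / scale N`. Starting at `Φ m` instead of 0 keeps `φ ≤ scale N`
    -- at all times, as the induction below requires.
    scale : ℕ → ℚ
    scale N = fromℕ (N ℕ.+ 2 ℕ.* sq m)

    Φ≤scale : ∀ N → Φ m ≤ scale N
    Φ≤scale N = fromℕ-mono (ℕP.m≤n+m (2 ℕ.* sq m) N)

    0<scale : ∀ N → 0ℚ < scale N
    0<scale N = <-≤-trans (positive⁻¹ 1ℚ) (fromℕ-mono {1}
      (ℕP.≤-trans (ℕP.≤-trans (ℕP.*-mono-≤ 0<m 0<m) (ℕP.m≤n*m (sq m) 2)) (ℕP.m≤n+m (2 ℕ.* sq m) N)))

    0≤Φ : 0ℚ ≤ Φ m
    0≤Φ = 0≤fromℕ (2 ℕ.* sq m)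

    increment-out : ∀ N {x y} → ¬ Inner R x y → scale N * increment N x y ≤ Φ m * φ m x
    increment-out N {x} {y} ¬d = ≤-by _ (0≤* 0≤Φ (0≤φ m x))
      (trans (cong₂ (λ a b → scale N * (a - b) + Φ m * φ m x) (hits-∉inner (suc N) ¬d) (hits-∉inner N ¬d))
        (lemma (scale N) (hits R k zero x y) (Φ m * φ m x)))
      where
      lemma : ∀ s a b → s * (a - a) + b ≡ b
      lemma = solve-∀ ℚ-ring

    -- Induction step: (M + 1) (φ - 1) ≤ M φ because φ ≤ Φ ≤ M.
    increment-bound : ∀ N x y → scale N * increment N x y ≤ Φ m * φ m x
    increment-bound = hits-induct (λ N x y → scale N * increment N x y ≤ Φ m * φ m x)
      base (λ N x y ¬d _ → increment-out (suc N) ¬d) step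
      where
      base : ∀ x y → scale zero * increment zero x y ≤ Φ m * φ m x
      base x y = by-cases (Inner? R x y)
        where
        by-cases : Dec (Inner R x y) → scale zero * increment zero x y ≤ Φ m * φ m x
        by-cases (no ¬d) = increment-out zero ¬d
        -- At time 0 the scale is `Φ m` itself, and the increment is at most 1, hence at most `φ`.
        by-cases (yes d) = *-monoˡ-≤-nonNeg (Φ m) {{ℚ.nonNegative 0≤Φ}}
          (≤-trans (≤-by _ (0≤hits zero x y) (lemma (hits R k 1 x y) (hits R k zero x y))) (≤-trans (hits≤1 1 x y) (1≤φ d)))
          where
          lemma : ∀ a b → a - b + b ≡ a
          lemma = solve-∀ ℚ-ring
      step : ∀ N → (∀ x y → scale N * increment N x y ≤ Φ m * φ m x) →
        ∀ x y → Inner R x y → scale (suc N) * increment (suc N) x y ≤ Φ m * φ m x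
      step N ih x y d = 4-cancel-≤ (*-cancelˡ-≤-pos M {{ℚ.positive (0<scale N)}}
        (≤-by _ (0≤+ (0≤* 0≤1+M (0≤diff average)) (0≤* (0≤* 0≤4 0≤Φ) (0≤+ (0≤diff (≤-trans (φ≤Φ m x) (Φ≤scale N))) (nonNegative⁻¹ 1ℚ))))
          (trans (cong (_+ rest) (regroup M (increment (suc N) x y)))
            (trans (cong (λ z → M * (1ℚ + M) * z + rest) 4d)
              (lemma M (Φ m) (φ m x) (nb (increment N) x y))))))
        where
        M : ℚ
        M = scale N
        0≤1+M : 0ℚ ≤ 1ℚ + M
        0≤1+M = 0≤fromℕ (suc (N ℕ.+ 2 ℕ.* sq m))
        average : M * nb (increment N) x y ≤ Φ m * (4ℚ * φ m x - 4ℚ)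
        average = subst₂ _≤_ (nb-scale M (increment N) x y)
          (trans (nb-scale (Φ m) (φ₂ m) x y) (cong (Φ m *_) (φ-inner d)))
          (nb-mono ih x y)
        rest : ℚ
        rest = (1ℚ + M) * (Φ m * (4ℚ * φ m x - 4ℚ) - M * nb (increment N) x y) + 4ℚ * Φ m * (M - φ m x + 1ℚ)
        4d : 4ℚ * increment (suc N) x y ≡ nb (increment N) x y
        4d = trans (distrib (hits R k (suc (suc N)) x y) (hits R k (suc N) x y))
          (trans (cong₂ _-_ (hits-inner R k (suc N) d) (hits-inner R k N d)) (sym (nb-diff (hits R k (suc N)) (hits R k N) x y)))
          where
          distrib : ∀ a b → 4ℚ * (a - b) ≡ 4ℚ * a - 4ℚ * b
          distrib = solve-∀ ℚ-ring
        regroup : ∀ M z → M * (4ℚ * ((1ℚ + M) * z)) ≡ M * (1ℚ + M) * (4ℚ * z)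
        regroup = solve-∀ ℚ-ring
        lemma : ∀ M F f n →
          M * (1ℚ + M) * n + ((1ℚ + M) * (F * (4ℚ * f - 4ℚ) - M * n) + 4ℚ * F * (M - f + 1ℚ)) ≡ M * (4ℚ * (F * f))
        lemma = solve-∀ ℚ-ring

    -- Monotonicity in time gives `sub` through the heat equation. For `super`, the increment is at
    -- most `Φ m * Φ m` divided by the scale, hence at most `δ`.
    h-Approx : ∀ {δ N} → In R (+ m) k → Φ m * Φ m ≤ scale N * δ → Approx R δ k (hits R k N)
    h-Approx {δ} {N} p small = record
      { 0≤v   = 0≤hits N
      ; v≤1   = hits≤1 N
      ; off   = hits-off R k N
      ; sub   = λ {x} {y} d → subst (4ℚ * hits R k N x y ≤_) (hits-inner R k N d) (*-monoˡ-≤-nonNeg 4ℚ (hits-mono N x y))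
      ; super = λ {x} {y} d → subst (_≤ 4ℚ * (hits R k N x y + δ)) (hits-inner R k N d) (*-monoˡ-≤-nonNeg 4ℚ (close x y))
      ; hit   = hits-hit R k N p
      ; miss  = hits-miss R k N
      }
      where
      close : ∀ x y → hits R k (suc N) x y ≤ hits R k N x y + δ
      close x y = ≤-by _ (0≤diff (*-cancelˡ-≤-pos (scale N) {{ℚ.positive (0<scale N)}} (≤-trans (increment-bound N x y)
          (≤-trans (*-monoˡ-≤-nonNeg (Φ m) {{ℚ.nonNegative 0≤Φ}} (φ≤Φ m x)) small))))
        (lemma (hits R k (suc N) x y) (hits R k N x y) δ)
        where
        lemma : ∀ a b d → a + (d - (a - b)) ≡ b + d
        lemma = solve-∀ ℚ-ring

-- The final estimate

hits-extend : ∀ {m} (R : Region m) k → In R (+ m) k → ∀ N x y → hits R k N x y ≤ hits (extend R) k N x y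
hits-extend {m} R k p = hits-induct R k (λ N x y → hits R k N x y ≤ hits (extend R) k N x y)
  (λ x y → base x y (Inner? R x y))
  (λ N x y ¬d _ → out (suc N) x y ¬d (x ℤ.≟ + m))
  (λ N ih x y d → 4-cancel-≤ (subst₂ _≤_ (sym (hits-inner R k N d)) (sym (hits-inner (extend R) k N (inner d))) (nb-mono ih x y)))
  where
  inner : ∀ {x y} → Inner R x y → Inner (extend R) x y
  inner (q , x≢m) = In-extend q , x≢m
  out : ∀ N x y → ¬ Inner R x y → Dec (x ≡ + m) → hits R k N x y ≤ hits (extend R) k N x y
  out N x y ¬d (no x≢m) = subst (_≤ hits (extend R) k N x y) (sym (hits-off R k N λ q → ¬d (q , x≢m))) (0≤hits (extend R) k N x y)
  out N x y ¬d (yes refl) = right (y ℤ.≟ k)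
    where
    right : Dec (y ≡ k) → hits R k N x y ≤ hits (extend R) k N x y
    right (yes refl) = ≤-reflexive (trans (hits-hit R k N p) (sym (hits-hit (extend R) k N (In-extend p))))
    right (no y≢k)   = ≤-reflexive (trans (hits-miss R k N y≢k) (sym (hits-miss (extend R) k N y≢k)))
  base : ∀ x y → Dec (Inner R x y) → hits R k zero x y ≤ hits (extend R) k zero x y
  base x y (yes d) = ≤-reflexive (trans (hits-inner₀ R k d) (sym (hits-inner₀ (extend R) k (inner d))))
  base x y (no ¬d) = out zero x y ¬d (x ℤ.≟ + m)

-- If H₊ ≤ ε then already f₊ ≤ ε; otherwise multiply by H₊ and cancel it.
ratio-chain : ∀ {ε K f₋ f₀ f₊ H₀ H₊} → 0ℚ < ε → 0ℚ ≤ K → K + K ≤ ε * ε →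
  0ℚ ≤ f₀ → f₀ ≤ 1ℚ → 0ℚ ≤ f₊ → f₊ ≤ 1ℚ → f₋ ≤ 1ℚ → f₊ ≤ H₊ →
  f₊ * H₀ ≤ f₀ * H₊ + K → f₋ * H₊ ≤ f₀ * H₀ + K → f₊ * f₋ ≤ f₀ * f₀ + ε
ratio-chain {ε} {K} {f₋} {f₀} {f₊} {H₀} {H₊} 0<ε 0≤K 2K≤ε² 0≤f₀ f₀≤1 0≤f₊ f₊≤1 f₋≤1 f₊≤H₊ up down =
  by-cases (H₊ ≤? ε)
  where
  by-cases : Dec (H₊ ≤ ε) → f₊ * f₋ ≤ f₀ * f₀ + ε
  by-cases (yes H₊≤ε) = ≤-by _
    (0≤+ (0≤+ (0≤+ (0≤* 0≤f₀ 0≤f₀) (0≤diff H₊≤ε)) (0≤diff f₊≤H₊)) (0≤* 0≤f₊ (0≤diff f₋≤1)))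
    (lemma ε f₋ f₀ f₊ H₊)
    where
    lemma : ∀ ε f₋ f₀ f₊ H₊ → f₊ * f₋ + (f₀ * f₀ + (ε - H₊) + (H₊ - f₊) + f₊ * (1ℚ - f₋)) ≡ f₀ * f₀ + ε
    lemma = solve-∀ ℚ-ring
  by-cases (no H₊≰ε) = *-cancelˡ-≤-pos H₊ {{ℚ.positive (<-trans 0<ε ε<H₊)}} (≤-by _
    (0≤+ (0≤+ (0≤+ (0≤+ (0≤+ (0≤* 0≤f₊ (0≤diff down)) (0≤* 0≤f₀ (0≤diff up)))
      (0≤* 0≤K (0≤diff f₊≤1))) (0≤* 0≤K (0≤diff f₀≤1))) (0≤diff 2K≤ε²)) (0≤* (<⇒≤ 0<ε) (0≤diff (<⇒≤ ε<H₊))))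
    (lemma ε K f₋ f₀ f₊ H₀ H₊))
    where
    ε<H₊ : ε < H₊
    ε<H₊ = ≰⇒> H₊≰ε
    lemma : ∀ ε K f₋ f₀ f₊ H₀ H₊ →
      H₊ * (f₊ * f₋) + (f₊ * (f₀ * H₀ + K - f₋ * H₊) + f₀ * (f₀ * H₊ + K - f₊ * H₀)
        + K * (1ℚ - f₊) + K * (1ℚ - f₀) + (ε * ε - (K + K)) + ε * (H₊ - ε))
      ≡ H₊ * (f₀ * f₀ + ε)
    lemma = solve-∀ ℚ-ring

theorem1p1 : (m : ℕ) → 0 ℕ.< m → (R : Region m) →
    lo R 0 ℤ.≤ + 0 → + 0 ℤ.≤ hi R 0 →
    (k : ℤ) → inβ R (+ m) (k ℤ.+ ℤ.1ℤ) ≡ true → inβ R (+ m) (k ℤ.- ℤ.1ℤ) ≡ true →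
    (ε : ℚ) → 0ℚ ℚ.< ε →
    ∃[ N₀ ] (∀ N → N₀ ℕ.≤ N →
    pN R N (k ℤ.+ ℤ.1ℤ) ℚ.* pN R N (k ℤ.- ℤ.1ℤ) ℚ.≤ pN R N k ℚ.* pN R N k ℚ.+ ε)
theorem1p1 m 0<m R lo≤0 0≤hi k k+1∈β k-1∈β ε 0<ε = N₀ , bound
  where
  24ℚ D : ℚ
  24ℚ = + 24 ℚ./ 1
  -- `K + K` consists of six errors `4 δ Φ`, so dividing `ε * ε` by `24 Φ` gives `K + K = ε * ε`, as
  -- `ratio-chain` requires.
  D = 24ℚ * Φ m
  instance
    Φ-pos : ℚ.Positive (Φ m)
    Φ-pos = ℚ.positive (0<scale R k 0<m 0)
    D-pos : ℚ.Positive D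
    D-pos = pos*pos⇒pos 24ℚ (Φ m)
    D-nonZero : ℚ.NonZero D
    D-nonZero = pos⇒nonZero D
    ε-pos : ℚ.Positive ε
    ε-pos = ℚ.positive 0<ε
    ε²-pos : ℚ.Positive (ε * ε)
    ε²-pos = pos*pos⇒pos ε ε
    1/D-pos : ℚ.Positive (ℚ.1/ D)
    1/D-pos = 1/pos⇒pos D

  δ : ℚ
  δ = ε * ε * ℚ.1/ D

  0<δ : 0ℚ < δ
  0<δ = positive⁻¹ δ {{pos*pos⇒pos (ε * ε) (ℚ.1/ D)}}

  -- The time from which `h-Approx` is available, since the scale at time `N` is at least `N`.
  Φ*Φ<N₀δ : ∃[ n ] Φ m * Φ m < fromℕ n * δ
  Φ*Φ<N₀δ = archimedean δ 0<δ (Φ m * Φ m)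

  N₀ : ℕ
  N₀ = proj₁ Φ*Φ<N₀δ

  κ K : ℚ
  κ = error m δ
  K = κ + κ + κ

  0≤κ : 0ℚ ≤ κ
  0≤κ = 0≤* (0≤* 0≤4 (<⇒≤ 0<δ)) (0≤fromℕ (2 ℕ.* sq m))

  2K≡ε² : K + K ≡ ε * ε
  2K≡ε² = trans (lemma (Φ m) (ε * ε) (ℚ.1/ D))
    (trans (cong (ε * ε *_) (*-inverseˡ D)) (*-identityʳ (ε * ε)))
    where
    lemma : ∀ F e d → let c = 4ℚ * (e * d) * F in (c + c + c) + (c + c + c) ≡ e * (d * (24ℚ * F))
    lemma = solve-∀ ℚ-ring

  O∈R : In R 0ℤ 0ℤ
  O∈R = inside ℕ.z≤n lo≤0 0≤hi

  k+1∈R : In R (+ m) (k ℤ.+ 1ℤ)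
  k+1∈R = inβ⇒In R k+1∈β

  k-1∈R : In R (+ m) (k ℤ.- 1ℤ)
  k-1∈R = inβ⇒In R k-1∈β

  k∈R : In R (+ m) k
  k∈R = between k+1∈R k-1∈R
    where
    between : In R (+ m) (k ℤ.+ 1ℤ) → In R (+ m) (k ℤ.- 1ℤ) → In R (+ m) k
    between (inside i≤m _ h) (inside _ l _) =
      inside i≤m (ℤP.≤-trans l (ℤP.i≤j⇒i-k≤j 1ℤ ℤP.≤-refl)) (ℤP.≤-trans (i≤i+1 k) h)

  bound : ∀ N → N₀ ℕ.≤ N →
    pN R N (k ℤ.+ 1ℤ) * pN R N (k ℤ.- 1ℤ) ≤ pN R N k * pN R N k + ε
  bound N N₀≤N = subst₂ _≤_
    (cong₂ _*_ (hits-pN R (k ℤ.+ 1ℤ) N O∈R) (hits-pN R (k ℤ.- 1ℤ) N O∈R))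
    (cong (λ z → z * z + ε) (hits-pN R k N O∈R))
    (ratio-chain {f₋ = hits R (k ℤ.- 1ℤ) N 0ℤ 0ℤ} {f₀ = hits R k N 0ℤ 0ℤ} {f₊ = hits R (k ℤ.+ 1ℤ) N 0ℤ 0ℤ}
      {H₀ = hits (extend R) k N 0ℤ 0ℤ} {H₊ = hits (extend R) (k ℤ.+ 1ℤ) N 0ℤ 0ℤ}
      0<ε (0≤+ (0≤+ 0≤κ 0≤κ) 0≤κ) (≤-reflexive 2K≡ε²)
      (0≤hits R k N 0ℤ 0ℤ) (hits≤1 R k N 0ℤ 0ℤ) (0≤hits R (k ℤ.+ 1ℤ) N 0ℤ 0ℤ) (hits≤1 R (k ℤ.+ 1ℤ) N 0ℤ 0ℤ)
      (hits≤1 R (k ℤ.- 1ℤ) N 0ℤ 0ℤ) (hits-extend R (k ℤ.+ 1ℤ) k+1∈R N 0ℤ 0ℤ)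
      -- Adding the top row compares the two regions at the origin itself, so `p = 0` here.
      (extension-ratio R 0<δ (approx R k∈R) (approx R k+1∈R)
        (approx (extend R) (In-extend k∈R)) (approx (extend R) (In-extend k+1∈R)) ℤP.≤-refl)
      (lower-extension-ratio R 0<δ (approx R k∈R) (approx R k-1∈R)
        (approx (extend R) (In-extend k∈R)) (approx (extend R) (In-extend k+1∈R))))
    where
    small : Φ m * Φ m ≤ fromℕ (N ℕ.+ 2 ℕ.* sq m) * δ
    small = ≤-trans (<⇒≤ (proj₂ Φ*Φ<N₀δ))
      (*-monoʳ-≤-nonNeg δ {{ℚ.nonNegative (<⇒≤ 0<δ)}} (fromℕ-mono (ℕP.≤-trans N₀≤N (ℕP.m≤m+n N (2 ℕ.* sq m)))))
    -- The scale depends only on `m` and `N`, so the same `δ` and `N` serve both regions and all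
    -- three targets.
    approx : ∀ (S : Region m) {j} → In S (+ m) j → Approx S δ j (hits S j N)
    approx S {j} p = h-Approx S j 0<m {N = N} p small
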